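{- Let $T_n(t)=\sum_{\pi\in F_n(321,3124)}t^{\operatorname{lrmax}(\pi)}$ and $T(t,x)=\sum_{n=0}^\infty T_n(t)x^n$. Then $$T(t,x)=\frac{1-(t+1)x+tx^2+tx^3}{(1-tx-tx^2)(1-tx)(1-x)}.$$
   Context: A Fishburn permutation is a permutation $\pi$ (in one-line notation) with no subsequence $\pi_j,\pi_{j+1},\pi_k$ such that $j+1<k$, $\pi_j=\pi_k+1$, and $\pi_{j+1}>\pi_j$. $F_n(321,3124)$ is the set of Fishburn permutations of length $n$ avoiding the classical patterns $321$ and $3124$ (i.e. having no subsequence with the same relative order as either); for $n=0$ it consists of the empty permutation. $\operatorname{lrmax}(\pi)$ is the number of left-to-right maxima of $\pi$, i.e. entries greater than all entries to their left. The identity is one of formal power series. -}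

module Defs where

open import Algebra.Bundles.Raw using (RawRing)
import Algebra.Definitions as AlgDef
import Algebra.Definitions.RawSemiring as RawSemiringDefs
open import Data.Fin.Base as Fin using (Fin; toℕ)
import Data.Fin.Properties as Finₚ
open import Data.Integer.Base using (+-*-rawRing)
open import Data.List.Base as List using (List; []; _∷_; filter; length; allFin; cartesianProductWith)
open import Data.List.Membership.Propositional using (_∈_; lose)
open import Data.List.Membership.Propositional.Properties using (∈-allFin; ∈-cartesianProductWith⁺)
import Data.List.Relation.Unary.Any as Any
import Data.List.Relation.Unary.All as All
import Data.List.Relation.Unary.AllPairs as ListAllPairs
import Data.List.Relation.Unary.Unique.Propositional as ListUnique
import Data.List.Relation.Unary.Unique.Propositional.Properties as ListUniqueₚ
open import Data.Nat.Base as ℕ using (ℕ; zero; suc; _∸_)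
import Data.Nat.Properties as ℕₚ
open import Data.Product.Base using (Σ-syntax; ∃-syntax; _×_; _,_; proj₁; uncurry)
open import Data.Vec.Base using (Vec; []; _∷_; lookup)
open import Data.Vec.Properties using (∷-injective)
open import Data.Vec.Relation.Unary.AllPairs using (allPairs?)
open import Data.Vec.Relation.Unary.Unique.Propositional using (Unique)
open import Function.Base using (_∘_)
open import Function.Bundles using (_⇔_; mk⇔; module Equivalence)
open import Level using (_⊔_)
open import Relation.Binary.PropositionalEquality.Core using (_≡_)
open import Relation.Nullary using (¬_; ¬?)
open import Relation.Nullary.Decidable using (map′; _×-dec_; _→-dec_)
open import Relation.Unary using (Decidable)

-- All words of length k over Fin n, each listed exactly once.
words : ∀ n k → List (Vec (Fin n) k)
words n zero    = [] ∷ []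
words n (suc k) = cartesianProductWith _∷_ (allFin n) (words n k)

∈-words : ∀ {n k} (w : Vec (Fin n) k) → w ∈ words n k
∈-words []      = Any.here _≡_.refl
∈-words (a ∷ w) = ∈-cartesianProductWith⁺ _∷_ (∈-allFin a) (∈-words w)

words-unique : ∀ n k → ListUnique.Unique (words n k)
words-unique n zero    = All.[] ListAllPairs.∷ ListAllPairs.[]
words-unique n (suc k) =
  ListUniqueₚ.cartesianProductWith⁺ _∷_ ∷-injective (ListUniqueₚ.allFin⁺ n) (words-unique n k)

-- A permutation of length n in one-line notation is a word w : Vec (Fin n) n
-- with Unique w.  Positions and values are counted from 0 rather than from 1;
-- every notion below is invariant under this shift.

HasFishburnPattern : ∀ {n} → Vec (Fin n) n → Set
HasFishburnPattern {n} w = ∃[ j ] ∃[ j′ ] ∃[ k ]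
  toℕ j′ ≡ suc (toℕ j) ×
  j′ Fin.< k ×
  toℕ (lookup w j) ≡ suc (toℕ (lookup w k)) ×
  lookup w j Fin.< lookup w j′

Increasing : ∀ {n k} → Vec (Fin n) k → Set
Increasing c = ∀ a b → a Fin.< b → lookup c a Fin.< lookup c b

-- The subsequence of w at the positions c has the same relative order as σ.
SameOrder : ∀ {n k} → Vec ℕ k → Vec (Fin n) n → Vec (Fin n) k → Set
SameOrder σ w c = ∀ a b →
  (lookup σ a ℕ.< lookup σ b) ⇔ (lookup w (lookup c a) Fin.< lookup w (lookup c b))

Contains : ∀ {n k} → Vec ℕ k → Vec (Fin n) n → Set
Contains σ w = ∃[ c ] Increasing c × SameOrder σ w c

pattern321 : Vec ℕ 3
pattern321 = 3 ∷ 2 ∷ 1 ∷ []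

pattern3124 : Vec ℕ 4
pattern3124 = 3 ∷ 1 ∷ 2 ∷ 4 ∷ []

record InF {n} (w : Vec (Fin n) n) : Set where
  field
    permutation : Unique w
    fishburn    : ¬ HasFishburnPattern w
    avoids321   : ¬ Contains pattern321 w
    avoids3124  : ¬ Contains pattern3124 w

hasFishburnPattern? : ∀ {n} → Decidable (HasFishburnPattern {n})
hasFishburnPattern? w = Finₚ.any? λ j → Finₚ.any? λ j′ → Finₚ.any? λ k →
  (toℕ j′ ℕₚ.≟ suc (toℕ j)) ×-dec
  (j′ Finₚ.<? k) ×-dec
  (toℕ (lookup w j) ℕₚ.≟ suc (toℕ (lookup w k))) ×-dec
  (lookup w j Finₚ.<? lookup w j′)

increasing? : ∀ {n k} → Decidable (Increasing {n} {k})
increasing? c = Finₚ.all? λ a → Finₚ.all? λ b →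
  (a Finₚ.<? b) →-dec (lookup c a Finₚ.<? lookup c b)

sameOrder? : ∀ {n k} (σ : Vec ℕ k) (w : Vec (Fin n) n) → Decidable (SameOrder σ w)
sameOrder? σ w c = Finₚ.all? λ a → Finₚ.all? λ b →
  let P? = lookup σ a ℕₚ.<? lookup σ b
      Q? = lookup w (lookup c a) Finₚ.<? lookup w (lookup c b)
  in map′ (uncurry mk⇔) (λ e → Equivalence.to e , Equivalence.from e)
          ((P? →-dec Q?) ×-dec (Q? →-dec P?))

contains? : ∀ {n k} (σ : Vec ℕ k) → Decidable (Contains {n} σ)
contains? {n} {k} σ w =
  map′ Any.satisfied (λ (c , p) → lose (∈-words c) p)
       (Any.any? (λ c → increasing? c ×-dec sameOrder? σ w c) (words n k))

inF? : ∀ {n} → Decidable (InF {n})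
inF? w = map′
  (λ (p , f , a , b) → record { permutation = p ; fishburn = f ; avoids321 = a ; avoids3124 = b })
  (λ m → let open InF m in permutation , fishburn , avoids321 , avoids3124)
  (allPairs? (λ a b → ¬? (a Finₚ.≟ b)) w ×-dec
   ¬? (hasFishburnPattern? w) ×-dec
   ¬? (contains? pattern321 w) ×-dec
   ¬? (contains? pattern3124 w))

F : ∀ n → List (Vec (Fin n) n)
F n = filter inF? (words n n)

IsLRMax : ∀ {n} → Vec (Fin n) n → Fin n → Set
IsLRMax w i = ∀ j → j Fin.< i → lookup w j Fin.< lookup w i

isLRMax? : ∀ {n} (w : Vec (Fin n) n) → Decidable (IsLRMax w)
isLRMax? w i = Finₚ.all? λ j → (j Finₚ.<? i) →-dec (lookup w j Finₚ.<? lookup w i)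

lrmax : ∀ {n} → Vec (Fin n) n → ℕ
lrmax {n} w = length (filter (isLRMax? w) (allFin n))

-- Formal power series in one variable over R, given by their coefficients.
module PowerSeries {c ℓ} (R : RawRing c ℓ) where
  private module R = RawRing R
  open RawSemiringDefs R.rawSemiring using (sum)

  Series : Set c
  Series = ℕ → R.Carrier

  constant : R.Carrier → Series
  constant r zero    = r
  constant r (suc _) = R.0#

  variable-series : Series
  variable-series 1 = R.1#
  variable-series _ = R.0#

  rawRing : RawRing c ℓ
  rawRing = record
    { Carrier = Series
    ; _≈_     = λ f g → ∀ n → f n R.≈ g n
    ; _+_     = λ f g n → f n R.+ g n
    ; _*_     = λ f g n → sum {suc n} (λ i → f (toℕ i) R.* g (n ∸ toℕ i))
    ; -_      = λ f n → R.- f n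
    ; 0#      = constant R.0#
    ; 1#      = constant R.1#
    }

-- F = N / D in a commutative ring: D is a unit and F = N · D⁻¹.
module Quotient {c ℓ} (R : RawRing c ℓ) where
  open RawRing R
  open AlgDef _≈_ using (Invertible)

  infix 4 _≈_÷_
  _≈_÷_ : Carrier → Carrier → Carrier → Set (c ⊔ ℓ)
  f ≈ n ÷ d = Σ[ d-unit ∈ Invertible 1# _*_ d ] f ≈ n * proj₁ d-unit

ℤ⟦t⟧ : RawRing _ _
ℤ⟦t⟧ = PowerSeries.rawRing +-*-rawRing

ℤ⟦t⟧⟦x⟧ : RawRing _ _
ℤ⟦t⟧⟦x⟧ = PowerSeries.rawRing ℤ⟦t⟧

-- Tₙ(t), a finite sum of powers of t, as an element of ℤ⟦t⟧.
Tₙ : ℕ → RawRing.Carrier ℤ⟦t⟧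
Tₙ n = List.foldr _+_ 0# (List.map (λ π → PowerSeries.variable-series +-*-rawRing ^ lrmax π) (F n))
  where
  open RawRing ℤ⟦t⟧ using (_+_; 0#; rawSemiring)
  open RawSemiringDefs rawSemiring using (_^_)

-- The series Σ Tₙ(t) xⁿ is its sequence of coefficients in x.
T : RawRing.Carrier ℤ⟦t⟧⟦x⟧
T = Tₙ

t x : RawRing.Carrier ℤ⟦t⟧⟦x⟧
t = PowerSeries.constant ℤ⟦t⟧ (PowerSeries.variable-series +-*-rawRing)
x = PowerSeries.variable-series ℤ⟦t⟧

open RawRing ℤ⟦t⟧⟦x⟧ public using (_+_; _*_; -_; 1#)
open RawSemiringDefs (RawRing.rawSemiring ℤ⟦t⟧⟦x⟧) public using (_^_)
open Quotient ℤ⟦t⟧⟦x⟧ public using (_≈_÷_)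

infixl 6 _-_
_-_ : RawRing.Carrier ℤ⟦t⟧⟦x⟧ → RawRing.Carrier ℤ⟦t⟧⟦x⟧ → RawRing.Carrier ℤ⟦t⟧⟦x⟧
f - g = f + (- g)

{-# OPTIONS --safe #-}
-- Split F_{n+2}(321,3124) by the first entry, counted from 0.  A leading 0 can be
-- removed.  If the first entry is k ≥ 1, the Fishburn condition together with
-- 321-avoidance forces the second entry to be 0, so for k = 1 the prefix 10 can be
-- removed.  For k ≥ 2, avoiding 3124 puts every entry above k before the entry 1, and
-- avoiding 321 sorts both groups, so that the only such word is
-- k, 0, k+1, …, n+1, 1, …, k-1, which has n-k+2 left-to-right maxima.  Hence
-- T_{n+2} = t T_{n+1} + t T_n + (t + t² + ⋯ + tⁿ), with T_0 = 1 and T_1 = t.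
module Submission where

open import Defs hiding (_+_; _*_; -_; 1#; _^_; _-_; t; x; T; _≈_÷_)

open import Algebra.Bundles using (CommutativeRing; RawRing)
import Algebra.Definitions.RawSemiring as RawSemiringDefinitions
import Algebra.Properties.CommutativeSemigroup as CommutativeSemigroupProperties
import Algebra.Properties.Ring as RingProperties
import Algebra.Solver.Ring.NaturalCoefficients.Default as SemiringSolver
open import Data.Fin.Base as Fin using (Fin; zero; suc; toℕ; fromℕ; fromℕ<)
open import Data.Fin.Patterns using (0F; 1F; 2F; 3F)
import Data.Fin.Properties as Finₚ
open import Data.Integer.Base using (+-*-rawRing)
import Data.Integer.Properties as ℤₚ
open import Data.List.Base as List using (List; []; _∷_; _++_; filter; length; allFin)
open import Data.List.Membership.Propositional using (_∈_)
open import Data.List.Membership.Propositional.Properties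
  using (∈-allFin; ∈-filter⁺; ∈-filter⁻; ∈-map⁺; ∈-map⁻; ∈-++⁺ˡ; ∈-++⁺ʳ; ∈-++⁻)
open import Data.List.Membership.Propositional.Properties.WithK using (unique∧set⇒bag)
import Data.List.Properties as Listₚ
open import Data.List.Relation.Binary.BagAndSetEquality using (∼bag⇒↭)
open import Data.List.Relation.Binary.Permutation.Propositional as Perm using (_↭_)
import Data.List.Relation.Unary.Unique.Propositional as ListUnique
import Data.List.Relation.Unary.Unique.Propositional.Properties as ListUniqueₚ
open import Data.Nat.Base as ℕ using (ℕ; zero; suc)
import Data.Nat.Properties as ℕₚ
open import Data.Product.Base using (∃; _×_; _,_; proj₁; proj₂)
open import Data.Sum.Base using ([_,_]′)
open import Data.Vec.Base using (Vec; []; _∷_; lookup; map; tabulate)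
open import Data.Vec.Properties
  using (lookup-map; tabulate∘lookup; lookup∘tabulate; tabulate-cong; ∷-injective; ∷-injectiveʳ)
import Data.Vec.Relation.Unary.All as All
import Data.Vec.Relation.Unary.All.Properties as Allₚ
import Data.Vec.Relation.Unary.AllPairs as AllPairs
open import Data.Vec.Relation.Unary.Unique.Propositional using (Unique)
open import Data.Vec.Relation.Unary.Unique.Propositional.Properties using (lookup-injective; tabulate⁺)
open import Function.Base using (_∘_; id)
open import Function.Bundles using (mk⇔; module Equivalence; _⇔_)
open import Function.Definitions using (Injective)
open import Relation.Binary.Definitions using (tri<; tri≈; tri>)
open import Relation.Binary.PropositionalEquality as ≡
  using (_≡_; _≗_; subst; subst₂; cong; cong₂)
import Relation.Binary.Reasoning.Setoid as SetoidReasoning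
open import Relation.Nullary using (Dec; ¬_; yes; no; contradiction)
open import Relation.Nullary.Decidable using (from-yes; _→-dec_)
open import Relation.Unary using (Pred; Decidable)

-- Formal power series

module PowerSeriesProperties {c ℓ} (R : CommutativeRing c ℓ) where

  private module R = CommutativeRing R
  open PowerSeries R.rawRing using (Series; constant; variable-series; rawRing)
  open RawRing rawRing
  open SetoidReasoning R.setoid
  open CommutativeSemigroupProperties R.+-commutativeSemigroup using (interchange; x∙yz≈y∙xz)

  private
    variable
      f g f′ g′ : Series

    tail : Series → Series
    tail f = f ∘ suc

  *-cong : f ≈ f′ → g ≈ g′ → f * g ≈ f′ * g′
  *-cong p q zero    = R.+-congʳ (R.*-cong (p 0) (q 0))
  *-cong p q (suc n) = R.+-cong (R.*-cong (p 0) (q (suc n))) (*-cong (p ∘ suc) q n)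

  -- The definition of the product unfolds to
  -- (f * g) (suc n) = f 0 * g (suc n) + (tail f * g) n;
  -- this is the mirror image.
  *-tailʳ : ∀ f g n → (f * g) (suc n) R.≈ f (suc n) R.* g 0 R.+ (f * tail g) n
  *-tailʳ f g zero    = x∙yz≈y∙xz _ _ _
  *-tailʳ f g (suc n) = begin
    f 0 R.* g (2 ℕ.+ n) R.+ (tail f * g) (suc n)
      ≈⟨ R.+-congˡ (*-tailʳ (tail f) g n) ⟩
    f 0 R.* g (2 ℕ.+ n) R.+ (f (2 ℕ.+ n) R.* g 0 R.+ (tail f * tail g) n)
      ≈⟨ x∙yz≈y∙xz _ _ _ ⟩
    f (2 ℕ.+ n) R.* g 0 R.+ (f * tail g) (suc n) ∎

  *-comm : ∀ f g → f * g ≈ g * f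
  *-comm f g zero    = R.+-congʳ (R.*-comm _ _)
  *-comm f g (suc n) = begin
    f 0 R.* g (suc n) R.+ (tail f * g) n ≈⟨ R.+-cong (R.*-comm _ _) (*-comm (tail f) g n) ⟩
    g (suc n) R.* f 0 R.+ (g * tail f) n ≈⟨ *-tailʳ g f n ⟨
    (g * f) (suc n)                      ∎

  *-distribʳ-+ : ∀ h f g → (f + g) * h ≈ f * h + g * h
  *-distribʳ-+ h f g zero = begin
    (f 0 R.+ g 0) R.* h 0 R.+ R.0#                        ≈⟨ R.+-cong (R.distribʳ _ _ _) (R.sym (R.+-identityˡ _)) ⟩
    (f 0 R.* h 0 R.+ g 0 R.* h 0) R.+ (R.0# R.+ R.0#)     ≈⟨ interchange _ _ _ _ ⟩
    (f 0 R.* h 0 R.+ R.0#) R.+ (g 0 R.* h 0 R.+ R.0#)     ∎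
  *-distribʳ-+ h f g (suc n) = R.trans
    (R.+-cong (R.distribʳ _ _ _) (*-distribʳ-+ h (tail f) (tail g) n))
    (interchange _ _ _ _)

  *-scaleˡ : ∀ r f g n → ((λ k → r R.* f k) * g) n R.≈ r R.* (f * g) n
  *-scaleˡ r f g zero = begin
    (r R.* f 0) R.* g 0 R.+ R.0#           ≈⟨ R.+-cong (R.*-assoc _ _ _) (R.sym (R.zeroʳ r)) ⟩
    r R.* (f 0 R.* g 0) R.+ r R.* R.0#     ≈⟨ R.distribˡ _ _ _ ⟨
    r R.* (f 0 R.* g 0 R.+ R.0#)           ∎
  *-scaleˡ r f g (suc n) = R.trans
    (R.+-cong (R.*-assoc _ _ _) (*-scaleˡ r (tail f) g n))
    (R.sym (R.distribˡ _ _ _))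

  *-assoc : ∀ f g h → (f * g) * h ≈ f * (g * h)
  *-assoc f g h zero = R.+-congʳ (begin
    (f 0 R.* g 0 R.+ R.0#) R.* h 0     ≈⟨ R.*-congʳ (R.+-identityʳ _) ⟩
    f 0 R.* g 0 R.* h 0                ≈⟨ R.*-assoc _ _ _ ⟩
    f 0 R.* (g 0 R.* h 0)              ≈⟨ R.*-congˡ (R.+-identityʳ _) ⟨
    f 0 R.* (g 0 R.* h 0 R.+ R.0#)     ∎)
  *-assoc f g h (suc n) = begin
    (f * g) 0 R.* h (suc n) R.+ (((λ k → f 0 R.* g (suc k)) + tail f * g) * h) n
      ≈⟨ R.+-cong (R.*-congʳ (R.+-identityʳ _)) (*-distribʳ-+ h (λ k → f 0 R.* g (suc k)) (tail f * g) n) ⟩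
    f 0 R.* g 0 R.* h (suc n) R.+ (((λ k → f 0 R.* g (suc k)) * h) n R.+ ((tail f * g) * h) n)
      ≈⟨ R.+-cong (R.*-assoc _ _ _) (R.+-cong (*-scaleˡ (f 0) (tail g) h n) (*-assoc (tail f) g h n)) ⟩
    f 0 R.* (g 0 R.* h (suc n)) R.+ (f 0 R.* (tail g * h) n R.+ (tail f * (g * h)) n)
      ≈⟨ R.+-assoc _ _ _ ⟨
    f 0 R.* (g 0 R.* h (suc n)) R.+ f 0 R.* (tail g * h) n R.+ (tail f * (g * h)) n
      ≈⟨ R.+-congʳ (R.distribˡ _ _ _) ⟨
    f 0 R.* (g * h) (suc n) R.+ (tail f * (g * h)) n ∎

  private
    zero-*ˡ : ∀ g n → ((λ _ → R.0#) * g) n R.≈ R.0#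
    zero-*ˡ g zero    = R.trans (R.+-identityʳ _) (R.zeroˡ _)
    zero-*ˡ g (suc n) = R.trans (R.+-cong (R.zeroˡ _) (zero-*ˡ g n)) (R.+-identityˡ _)

  constant-* : ∀ r g n → (constant r * g) n R.≈ r R.* g n
  constant-* r g zero    = R.+-identityʳ _
  constant-* r g (suc n) = R.trans (R.+-congˡ (zero-*ˡ g n)) (R.+-identityʳ _)

  *-identityˡ : ∀ f → 1# * f ≈ f
  *-identityˡ f n = R.trans (constant-* R.1# f n) (R.*-identityˡ _)

  variable-*-zero : ∀ g → (variable-series * g) 0 R.≈ R.0#
  variable-*-zero g = R.trans (R.+-identityʳ _) (R.zeroˡ _)

  variable-*-suc : ∀ g n → (variable-series * g) (suc n) R.≈ g n
  variable-*-suc g n = begin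
    R.0# R.* g (suc n) R.+ (tail variable-series * g) n ≈⟨ R.+-congʳ (R.zeroˡ _) ⟩
    R.0# R.+ (tail variable-series * g) n               ≈⟨ R.+-identityˡ _ ⟩
    (tail variable-series * g) n                        ≈⟨ *-cong {g = g} tail-variable (λ _ → R.refl) n ⟩
    (1# * g) n                                          ≈⟨ *-identityˡ g n ⟩
    g n                                                 ∎
    where
    tail-variable : tail variable-series ≈ 1#
    tail-variable zero    = R.refl
    tail-variable (suc _) = R.refl

  0≈ : ∀ n → 0# n R.≈ R.0#
  0≈ zero    = R.refl
  0≈ (suc _) = R.refl

  commutativeRing : CommutativeRing c ℓ
  commutativeRing = record
    { isCommutativeRing = record
      { isRing = record
        { +-isAbelianGroup = record
          { isGroup = record
            { isMonoid = record
              { isSemigroup = record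
                { isMagma = record
                  { isEquivalence = record
                    { refl  = λ _ → R.refl
                    ; sym   = λ p n → R.sym (p n)
                    ; trans = λ p q n → R.trans (p n) (q n)
                    }
                  ; ∙-cong = λ p q n → R.+-cong (p n) (q n)
                  }
                ; assoc = λ _ _ _ _ → R.+-assoc _ _ _
                }
              ; identity = (λ f n → R.trans (R.+-congʳ (0≈ n)) (R.+-identityˡ _))
                         , (λ f n → R.trans (R.+-congˡ (0≈ n)) (R.+-identityʳ _))
              }
            ; inverse = (λ f n → R.trans (R.-‿inverseˡ _) (R.sym (0≈ n)))
                      , (λ f n → R.trans (R.-‿inverseʳ _) (R.sym (0≈ n)))
            ; ⁻¹-cong = λ p n → R.-‿cong (p n)
            }
          ; comm = λ _ _ _ → R.+-comm _ _
          }
        ; *-cong = *-cong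
        ; *-assoc = *-assoc
        ; *-identity = *-identityˡ , λ f n → R.trans (*-comm f 1# n) (*-identityˡ f n)
        ; distrib = (λ h f g n → R.trans (*-comm h (f + g) n)
                      (R.trans (*-distribʳ-+ h f g n) (R.+-cong (*-comm f h n) (*-comm g h n))))
                  , *-distribʳ-+
        }
      ; *-comm = *-comm
      }
    }

module ListSum {c ℓ} (R : CommutativeRing c ℓ) where

  open CommutativeRing R
  open CommutativeSemigroupProperties +-commutativeSemigroup using (x∙yz≈y∙xz)

  module _ {a} {A : Set a} where

    ∑ : (A → Carrier) → List A → Carrier
    ∑ f xs = List.foldr _+_ 0# (List.map f xs)

    ∑-↭ : ∀ f {xs ys} → xs ↭ ys → ∑ f xs ≈ ∑ f ys
    ∑-↭ f Perm.refl         = refl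
    ∑-↭ f (Perm.prep _ p)   = +-congˡ (∑-↭ f p)
    ∑-↭ f (Perm.swap _ _ p) = trans (x∙yz≈y∙xz _ _ _) (+-congˡ (+-congˡ (∑-↭ f p)))
    ∑-↭ f (Perm.trans p q)  = trans (∑-↭ f p) (∑-↭ f q)

    ∑-++ : ∀ f xs ys → ∑ f (xs ++ ys) ≈ ∑ f xs + ∑ f ys
    ∑-++ f []       ys = sym (+-identityˡ _)
    ∑-++ f (x ∷ xs) ys = trans (+-congˡ (∑-++ f xs ys)) (sym (+-assoc _ _ _))

  module _ {a b} {A : Set a} {B : Set b} where

    ∑-map : ∀ {f : B → Carrier} {g : A → Carrier} (h : A → B) → (∀ x → f (h x) ≈ g x) →
            ∀ xs → ∑ f (List.map h xs) ≈ ∑ g xs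
    ∑-map h eq []       = refl
    ∑-map h eq (x ∷ xs) = +-cong (eq x) (∑-map h eq xs)

  ∑-*ˡ : ∀ {a} {A : Set a} r (f : A → Carrier) xs → ∑ (λ x → r * f x) xs ≈ r * ∑ f xs
  ∑-*ˡ r f []       = sym (zeroʳ r)
  ∑-*ˡ r f (x ∷ xs) = trans (+-congˡ (∑-*ˡ r f xs)) (sym (distribˡ _ _ _))

module Recurrences {c ℓ} (R : CommutativeRing c ℓ) (s : CommutativeRing.Carrier R) where

  private module R = CommutativeRing R
  open PowerSeries R.rawRing using (Series; constant; variable-series)
  open PowerSeriesProperties R using (commutativeRing; constant-*; variable-*-zero; variable-*-suc)
  open CommutativeRing commutativeRing
  open RawSemiringDefinitions (RawRing.rawSemiring rawRing) using (_^_)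
  open SemiringSolver commutativeSemiring using (solve; _:+_; _:*_; _:=_; con)
  open SetoidReasoning R.setoid

  t x : Series
  t = constant s
  x = variable-series

  x-recurrence : ∀ {f h : Series} → f 0 R.≈ h 0 → (∀ n → f (suc n) R.≈ h (suc n) R.+ f n) →
                 f ≈ h + x * f
  x-recurrence {f} {h} base step zero =
    R.trans base (R.sym (R.trans (R.+-congˡ (variable-*-zero f)) (R.+-identityʳ _)))
  x-recurrence {f} {h} base step (suc n) =
    R.trans (step n) (R.+-congˡ (R.sym (variable-*-suc f n)))

  t*-cong : ∀ {r} f n → f n R.≈ r → (t * f) n R.≈ s R.* r
  t*-cong f n eq = R.trans (constant-* s f n) (R.*-congˡ eq)

  tx-zero : ∀ f → (t * x * f) 0 R.≈ R.0#
  tx-zero f = R.trans (*-assoc t x f 0) (R.trans (t*-cong (x * f) 0 (variable-*-zero f)) (R.zeroʳ s))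

  tx-suc : ∀ f n → (t * x * f) (suc n) R.≈ s R.* f n
  tx-suc f n = R.trans (*-assoc t x f (suc n)) (t*-cong (x * f) (suc n) (variable-*-suc f n))

  private
    x²-* : ∀ f → x ^ 2 * f ≈ x * (x * f)
    x²-* = solve 2 (λ x f → x :* (x :* con 1) :* f := x :* (x :* f)) refl x

  x²-zero : ∀ f → (x ^ 2 * f) 0 R.≈ R.0#
  x²-zero f = R.trans (x²-* f 0) (variable-*-zero (x * f))

  x²-one : ∀ f → (x ^ 2 * f) 1 R.≈ R.0#
  x²-one f = R.trans (x²-* f 1) (R.trans (variable-*-suc (x * f) 0) (variable-*-zero f))

  x²-suc-suc : ∀ f n → (x ^ 2 * f) (2 ℕ.+ n) R.≈ f n
  x²-suc-suc f n = R.trans (x²-* f (2 ℕ.+ n)) (R.trans (variable-*-suc (x * f) (suc n)) (variable-*-suc f n))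

  tx-recurrence : ∀ {f h : Series} → f 0 R.≈ h 0 → (∀ n → f (suc n) R.≈ h (suc n) R.+ s R.* f n) →
                  f ≈ h + t * x * f
  tx-recurrence {f} {h} base step zero =
    R.trans base (R.sym (R.trans (R.+-congˡ (tx-zero f)) (R.+-identityʳ _)))
  tx-recurrence {f} {h} base step (suc n) = R.trans (step n) (R.+-congˡ (R.sym (tx-suc f n)))

  tx+tx²-recurrence : ∀ {f h : Series} → f 0 R.≈ h 0 → f 1 R.≈ h 1 R.+ s R.* f 0 →
    (∀ n → f (2 ℕ.+ n) R.≈ h (2 ℕ.+ n) R.+ (s R.* f (suc n) R.+ s R.* f n)) →
    f ≈ h + (t * x + t * x ^ 2) * f
  tx+tx²-recurrence {f} {h} base₀ base₁ step n = R.trans (pointwise n) (R.+-congˡ (R.sym (begin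
    ((t * x + t * x ^ 2) * f) n               ≈⟨ distribʳ f (t * x) (t * x ^ 2) n ⟩
    (t * x * f) n R.+ (t * x ^ 2 * f) n       ≈⟨ R.+-congˡ (*-assoc t (x ^ 2) f n) ⟩
    (t * x * f) n R.+ (t * (x ^ 2 * f)) n     ∎)))
    where
    pointwise : ∀ n → f n R.≈ h n R.+ ((t * x * f) n R.+ (t * (x ^ 2 * f)) n)
    pointwise zero = R.trans base₀ (R.sym (begin
      h 0 R.+ ((t * x * f) 0 R.+ (t * (x ^ 2 * f)) 0)  ≈⟨ R.+-congˡ (R.+-cong (tx-zero f) (t*-cong (x ^ 2 * f) 0 (x²-zero f))) ⟩
      h 0 R.+ (R.0# R.+ s R.* R.0#)                    ≈⟨ R.+-congˡ (R.trans (R.+-identityˡ _) (R.zeroʳ s)) ⟩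
      h 0 R.+ R.0#                                     ≈⟨ R.+-identityʳ _ ⟩
      h 0                                              ∎))
    pointwise (suc zero) = R.trans base₁ (R.+-congˡ (R.sym (begin
      (t * x * f) 1 R.+ (t * (x ^ 2 * f)) 1            ≈⟨ R.+-cong (tx-suc f 0) (t*-cong (x ^ 2 * f) 1 (x²-one f)) ⟩
      s R.* f 0 R.+ s R.* R.0#                         ≈⟨ R.+-congˡ (R.zeroʳ s) ⟩
      s R.* f 0 R.+ R.0#                               ≈⟨ R.+-identityʳ _ ⟩
      s R.* f 0                                        ∎)))
    pointwise (suc (suc n)) = R.trans (step n) (R.+-congˡ (R.sym
      (R.+-cong (tx-suc f (suc n)) (t*-cong (x ^ 2 * f) (2 ℕ.+ n) (x²-suc-suc f n)))))

module RationalForm {c ℓ} (R : CommutativeRing c ℓ) where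

  open CommutativeRing R
  open RawSemiringDefinitions (RawRing.rawSemiring rawRing) using (_^_)
  open Quotient rawRing using (_≈_÷_)
  open CommutativeSemigroupProperties *-commutativeSemigroup using (interchange)
  open RingProperties ring using (-‿+-comm; -‿distribˡ-*; -‿distribʳ-*; -‿involutive)
  open SemiringSolver commutativeSemiring using (solve; _:+_; _:*_; _:=_; con)
  open SetoidReasoning setoid

  unwind : ∀ {f r w} → f ≈ r + w * f → (1# - w) * f ≈ r
  unwind {f} {r} {w} eq = begin
    (1# - w) * f              ≈⟨ distribʳ f 1# (- w) ⟩
    1# * f + - w * f          ≈⟨ +-cong (*-identityˡ f) (sym (-‿distribˡ-* w f)) ⟩
    f - w * f                 ≈⟨ +-congʳ eq ⟩
    (r + w * f) - w * f       ≈⟨ +-assoc _ _ _ ⟩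
    r + (w * f - w * f)       ≈⟨ +-congˡ (-‿inverseʳ _) ⟩
    r + 0#                    ≈⟨ +-identityʳ r ⟩
    r                         ∎

  ÷-intro : ∀ {f n d} d⁻¹ → d * d⁻¹ ≈ 1# → d * f ≈ n → f ≈ n ÷ d
  ÷-intro {f} {n} {d} d⁻¹ dd⁻¹≈1 df≈n = (d⁻¹ , trans (*-comm _ _) dd⁻¹≈1 , dd⁻¹≈1) , (begin
    f              ≈⟨ *-identityˡ f ⟨
    1# * f         ≈⟨ *-congʳ dd⁻¹≈1 ⟨
    d * d⁻¹ * f    ≈⟨ solve 3 (λ d e f → d :* e :* f := d :* f :* e) refl d d⁻¹ f ⟩
    d * f * d⁻¹    ≈⟨ *-congʳ df≈n ⟩
    n * d⁻¹        ∎)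

  module _ (t x : Carrier) where

    private
      A B C N : Carrier
      A = 1# - t * x - t * x ^ 2
      B = 1# - t * x
      C = 1# - x
      N = 1# - (t + 1#) * x + t * x ^ 2 + t * x ^ 3

    1-tx-tx²-unwind : ∀ {f r} → f ≈ r + (t * x + t * x ^ 2) * f → A * f ≈ r
    1-tx-tx²-unwind eq = trans
      (*-congʳ (trans (+-assoc _ _ _) (+-congˡ (-‿+-comm _ _))))
      (unwind eq)

    numerator : B * C + t * x ^ 3 ≈ N
    numerator = +-congʳ (begin
      (1# - t * x) * (1# - x)
        ≈⟨ *-congʳ (+-congˡ (-‿distribʳ-* t x)) ⟩
      (1# + t * - x) * (1# - x)
        ≈⟨ solve 2 (λ t y → (con 1 :+ t :* y) :* (con 1 :+ y)
                         := con 1 :+ (t :+ con 1) :* y :+ t :* (y :* (y :* con 1))) refl t (- x) ⟩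
      1# + (t + 1#) * - x + t * (- x) ^ 2
        ≈⟨ +-cong (+-congˡ (sym (-‿distribʳ-* _ x))) (*-congˡ square) ⟩
      1# - (t + 1#) * x + t * x ^ 2 ∎)
      where
      square : (- x) ^ 2 ≈ x ^ 2
      square = begin
        - x * (- x * 1#)     ≈⟨ *-congˡ (-‿distribˡ-* x 1#) ⟨
        - x * - (x * 1#)     ≈⟨ -‿distribˡ-* x _ ⟨
        - (x * - (x * 1#))   ≈⟨ -‿cong (-‿distribʳ-* x _) ⟨
        - - (x * (x * 1#))   ≈⟨ -‿involutive _ ⟩
        x * (x * 1#)         ∎

    rational-form : ∀ {f p q e g} →
      f ≈ (1# + x ^ 2 * p) + (t * x + t * x ^ 2) * f →
      p ≈ t * x * e + x * p →
      q ≈ 1# + x * q →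
      e ≈ 1# + t * x * e →
      g ≈ 1# + (t * x + t * x ^ 2) * g →
      f ≈ N ÷ (A * B * C)
    rational-form {f} {p} {q} {e} {g} f-rec p-rec q-rec e-rec g-rec =
      ÷-intro (g * e * q)
        (begin
          (A * B * C) * (g * e * q)       ≈⟨ interchange (A * B) C (g * e) q ⟩
          (A * B) * (g * e) * (C * q)     ≈⟨ *-congʳ (interchange A B g e) ⟩
          (A * g) * (B * e) * (C * q)     ≈⟨ *-cong (*-cong (1-tx-tx²-unwind g-rec) (unwind e-rec)) (unwind q-rec) ⟩
          1# * 1# * 1#                    ≈⟨ *-congʳ (*-identityˡ 1#) ⟩
          1# * 1#                         ≈⟨ *-identityˡ 1# ⟩
          1#                              ∎)
        (begin
          (A * B * C) * f                       ≈⟨ solve 4 (λ a b c f → a :* b :* c :* f := b :* c :* (a :* f)) refl A B C f ⟩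
          B * C * (A * f)                       ≈⟨ *-congˡ (1-tx-tx²-unwind f-rec) ⟩
          B * C * (1# + x ^ 2 * p)              ≈⟨ solve 4 (λ b c y p → b :* c :* (con 1 :+ y :* p)
                                                         := b :* c :+ y :* (b :* (c :* p))) refl B C (x ^ 2) p ⟩
          B * C + x ^ 2 * (B * (C * p))         ≈⟨ +-congˡ (*-congˡ (*-congˡ (unwind p-rec))) ⟩
          B * C + x ^ 2 * (B * (t * x * e))     ≈⟨ solve 5 (λ bc x b t e → bc :+ x :* (x :* con 1) :* (b :* (t :* x :* e))
                                                         := bc :+ t :* (x :* (x :* (x :* (b :* e))))) refl (B * C) x B t e ⟩
          B * C + t * (x * (x * (x * (B * e)))) ≈⟨ +-congˡ (*-congˡ (*-congˡ (*-congˡ (*-congˡ (unwind e-rec))))) ⟩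
          B * C + t * x ^ 3                     ≈⟨ numerator ⟩
          N                                     ∎)

-- Fishburn permutations avoiding 321 and 3124

module FishburnPermutations where

  open ≡ using (refl; sym; trans)
  open import Data.Nat.Base using (_+_; _∸_; _≤_; _<_; z≤n; s≤s; z<s; s<s; s<s⁻¹)

  private
    variable
      m n : ℕ

  record Avoids (g : Fin n → ℕ) : Set where
    field
      injective : ∀ {i j} → g i ≡ g j → i ≡ j
      fishburn  : ∀ {i j k} → toℕ j ≡ suc (toℕ i) → j Fin.< k → g i ≡ suc (g k) → ¬ g i < g j
      no321     : ∀ {i j k} → i Fin.< j → j Fin.< k → g k < g j → ¬ g j < g i
      no3124    : ∀ {i j k l} → i Fin.< j → j Fin.< k → k Fin.< l →
                  g j < g k → g k < g i → ¬ g i < g l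

  value : Vec (Fin m) n → Fin n → ℕ
  value w i = toℕ (lookup w i)

  avoids-resp-≗ : {f g : Fin n → ℕ} → f ≗ g → Avoids f → Avoids g
  avoids-resp-≗ {f = f} {g} f≗g av = record
    { injective = λ {i} {j} p → injective (trans (f≗g i) (trans p (sym (f≗g j))))
    ; fishburn  = λ {i} {j} {k} p q r s →
        fishburn p q (trans (f≗g i) (trans r (cong suc (sym (f≗g k))))) (back s)
    ; no321     = λ p q r s → no321 p q (back r) (back s)
    ; no3124    = λ p q r s t u → no3124 p q r (back s) (back t) (back u)
    }
    where
    open Avoids av
    back : ∀ {i j} → g i < g j → f i < f j
    back {i} {j} = subst₂ _<_ (sym (f≗g i)) (sym (f≗g j))

  increasing⁺ : {c : Vec (Fin n) m} → AllPairs.AllPairs Fin._<_ c → Increasing c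
  increasing⁺ (p AllPairs.∷ _)  zero    (suc b) _         = Allₚ.lookup⁺ p b
  increasing⁺ (_ AllPairs.∷ ps) (suc a) (suc b) (s<s a<b) = increasing⁺ ps a b a<b

  lookup-injective? : (σ : Vec ℕ m) → Dec (∀ a b → lookup σ a ≡ lookup σ b → a ≡ b)
  lookup-injective? σ = Finₚ.all? λ a → Finₚ.all? λ b →
    (lookup σ a ℕₚ.≟ lookup σ b) →-dec (a Finₚ.≟ b)

  contains⁺ : (σ : Vec ℕ m) (w : Vec (Fin n) n) (c : Vec (Fin n) m) →
              (∀ a b → lookup σ a ≡ lookup σ b → a ≡ b) →
              Increasing c →
              (∀ a b → lookup σ a < lookup σ b → value w (lookup c a) < value w (lookup c b)) →
              Contains σ w
  contains⁺ σ w c σ-injective inc mono = c , inc , λ a b → mk⇔ (mono a b) (reflects a b)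
    where
    reflects : ∀ a b → value w (lookup c a) < value w (lookup c b) → lookup σ a < lookup σ b
    reflects a b lt with ℕₚ.<-cmp (lookup σ a) (lookup σ b)
    ... | tri< σa<σb _ _ = σa<σb
    ... | tri≈ _ σa≡σb _ with refl ← σ-injective a b σa≡σb = contradiction lt (ℕₚ.<-irrefl refl)
    ... | tri> _ _ σb<σa = contradiction lt (ℕₚ.<-asym (mono b a σb<σa))

  contains-321 : (w : Vec (Fin n) n) {i j k : Fin n} → i Fin.< j → j Fin.< k →
                 value w k < value w j → value w j < value w i → Contains pattern321 w
  contains-321 w {i} {j} {k} i<j j<k wk<wj wj<wi =
    contains⁺ pattern321 w (i ∷ j ∷ k ∷ [])
      (from-yes (lookup-injective? pattern321))
      (increasing⁺ ((i<j All.∷ Finₚ.<-trans i<j j<k All.∷ All.[])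
        AllPairs.∷ (j<k All.∷ All.[]) AllPairs.∷ All.[] AllPairs.∷ AllPairs.[]))
      mono
    where
    mono : ∀ a b → lookup pattern321 a < lookup pattern321 b →
           value w (lookup (i ∷ j ∷ k ∷ []) a) < value w (lookup (i ∷ j ∷ k ∷ []) b)
    mono 1F 0F _ = wj<wi
    mono 2F 0F _ = ℕₚ.<-trans wk<wj wj<wi
    mono 2F 1F _ = wk<wj
    mono 0F 0F (s≤s (s≤s (s≤s ())))
    mono 0F 1F (s≤s (s≤s ()))
    mono 0F 2F (s≤s ())
    mono 1F 1F (s≤s (s≤s ()))
    mono 1F 2F (s≤s ())
    mono 2F 2F (s≤s ())

  contains-3124 : (w : Vec (Fin n) n) {i j k l : Fin n} → i Fin.< j → j Fin.< k → k Fin.< l →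
                  value w j < value w k → value w k < value w i → value w i < value w l →
                  Contains pattern3124 w
  contains-3124 w {i} {j} {k} {l} i<j j<k k<l wj<wk wk<wi wi<wl =
    contains⁺ pattern3124 w (i ∷ j ∷ k ∷ l ∷ [])
      (from-yes (lookup-injective? pattern3124))
      (increasing⁺ ((i<j All.∷ i<k All.∷ Finₚ.<-trans i<k k<l All.∷ All.[])
        AllPairs.∷ (j<k All.∷ Finₚ.<-trans j<k k<l All.∷ All.[])
        AllPairs.∷ (k<l All.∷ All.[]) AllPairs.∷ All.[] AllPairs.∷ AllPairs.[]))
      mono
    where
    i<k = Finₚ.<-trans i<j j<k
    mono : ∀ a b → lookup pattern3124 a < lookup pattern3124 b →
           value w (lookup (i ∷ j ∷ k ∷ l ∷ []) a) < value w (lookup (i ∷ j ∷ k ∷ l ∷ []) b)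
    mono 0F 3F _ = wi<wl
    mono 1F 0F _ = ℕₚ.<-trans wj<wk wk<wi
    mono 1F 2F _ = wj<wk
    mono 1F 3F _ = ℕₚ.<-trans wj<wk (ℕₚ.<-trans wk<wi wi<wl)
    mono 2F 0F _ = wk<wi
    mono 2F 3F _ = ℕₚ.<-trans wk<wi wi<wl
    mono 0F 0F (s≤s (s≤s (s≤s ())))
    mono 0F 1F (s≤s ())
    mono 0F 2F (s≤s (s≤s ()))
    mono 1F 1F (s≤s ())
    mono 2F 1F (s≤s ())
    mono 2F 2F (s≤s (s≤s ()))
    mono 3F 0F (s≤s (s≤s (s≤s ())))
    mono 3F 1F (s≤s ())
    mono 3F 2F (s≤s (s≤s ()))
    mono 3F 3F (s≤s (s≤s (s≤s (s≤s ()))))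

  InF⇒Avoids : {w : Vec (Fin n) n} → InF w → Avoids (value w)
  InF⇒Avoids {w = w} w∈F = record
    { injective = lookup-injective permutation _ _ ∘ Finₚ.toℕ-injective
    ; fishburn  = λ p q r s → fishburn (_ , _ , _ , p , q , r , s)
    ; no321     = λ p q r s → avoids321 (contains-321 w p q r s)
    ; no3124    = λ p q r s t u → avoids3124 (contains-3124 w p q r s t u)
    }
    where open InF w∈F

  Avoids⇒InF : {w : Vec (Fin n) n} → Avoids (value w) → InF w
  Avoids⇒InF {w = w} av = record
    { permutation = subst Unique (tabulate∘lookup w) (tabulate⁺ (injective ∘ cong toℕ))
    ; fishburn    = λ (_ , _ , _ , p , q , r , s) → fishburn p q r s
    ; avoids321   = λ (c , inc , same) → no321 (inc 0F 1F z<s) (inc 1F 2F (s<s z<s))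
        (Equivalence.to (same 2F 1F) (s<s z<s)) (Equivalence.to (same 1F 0F) (s<s (s<s z<s)))
    ; avoids3124  = λ (c , inc , same) → no3124 (inc 0F 1F z<s) (inc 1F 2F (s<s z<s)) (inc 2F 3F (s<s (s<s z<s)))
        (Equivalence.to (same 1F 2F) (s<s z<s)) (Equivalence.to (same 2F 0F) (s<s (s<s z<s)))
        (Equivalence.to (same 0F 3F) (s<s (s<s (s<s z<s))))
    }
    where open Avoids av

  infix 5 0⊕_ 10⊕_ 0⊕ᵛ_ 10⊕ᵛ_

  0⊕_ : (Fin n → ℕ) → Fin (suc n) → ℕ
  (0⊕ g) zero    = 0
  (0⊕ g) (suc i) = suc (g i)

  10⊕_ : (Fin n → ℕ) → Fin (2 + n) → ℕ
  (10⊕ g) 0F            = 1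
  (10⊕ g) 1F            = 0
  (10⊕ g) (suc (suc i)) = 2 + g i

  0⊕ᵛ_ : Vec (Fin m) n → Vec (Fin (suc m)) (suc n)
  0⊕ᵛ w = zero ∷ map suc w

  10⊕ᵛ_ : Vec (Fin m) n → Vec (Fin (2 + m)) (2 + n)
  10⊕ᵛ w = 1F ∷ 0F ∷ map (2 Fin.↑ʳ_) w

  value-0⊕ : (w : Vec (Fin m) n) → value (0⊕ᵛ w) ≗ 0⊕ value w
  value-0⊕ w zero    = refl
  value-0⊕ w (suc i) = cong toℕ (lookup-map i suc w)

  value-10⊕ : (w : Vec (Fin m) n) → value (10⊕ᵛ w) ≗ 10⊕ value w
  value-10⊕ w 0F            = refl
  value-10⊕ w 1F            = refl
  value-10⊕ w (suc (suc i)) = cong toℕ (lookup-map i (2 Fin.↑ʳ_) w)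

  module _ {g : Fin n → ℕ} where

    0⊕-avoids⁺ : Avoids g → Avoids (0⊕ g)
    0⊕-avoids⁺ av = record
      { injective = inj ; fishburn = fish ; no321 = n321 ; no3124 = n3124 }
      where
      open Avoids av
      inj : ∀ {i j} → (0⊕ g) i ≡ (0⊕ g) j → i ≡ j
      inj {zero}  {zero}  _ = refl
      inj {suc i} {suc j} p = cong suc (injective (ℕₚ.suc-injective p))
      fish : ∀ {i j k} → toℕ j ≡ suc (toℕ i) → j Fin.< k → (0⊕ g) i ≡ suc ((0⊕ g) k) → ¬ (0⊕ g) i < (0⊕ g) j
      fish {suc i} {suc j} {suc k} p (s<s q) r (s<s s) =
        fishburn (ℕₚ.suc-injective p) q (ℕₚ.suc-injective r) s
      n321 : ∀ {i j k} → i Fin.< j → j Fin.< k → (0⊕ g) k < (0⊕ g) j → ¬ (0⊕ g) j < (0⊕ g) i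
      n321 {suc i} {suc j} {suc k} (s<s p) (s<s q) (s<s r) (s<s s) = no321 p q r s
      n3124 : ∀ {i j k l} → i Fin.< j → j Fin.< k → k Fin.< l →
              (0⊕ g) j < (0⊕ g) k → (0⊕ g) k < (0⊕ g) i → ¬ (0⊕ g) i < (0⊕ g) l
      n3124 {suc i} {suc j} {suc k} {suc l} (s<s p) (s<s q) (s<s r) (s<s s) (s<s t) (s<s u) =
        no3124 p q r s t u

    0⊕-avoids⁻ : Avoids (0⊕ g) → Avoids g
    0⊕-avoids⁻ av = record
      { injective = Finₚ.suc-injective ∘ injective ∘ cong suc
      ; fishburn  = λ p q r s → fishburn (cong suc p) (s<s q) (cong suc r) (s<s s)
      ; no321     = λ p q r s → no321 (s<s p) (s<s q) (s<s r) (s<s s)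
      ; no3124    = λ p q r s t u → no3124 (s<s p) (s<s q) (s<s r) (s<s s) (s<s t) (s<s u)
      }
      where open Avoids av

    10⊕-avoids⁺ : Avoids g → Avoids (10⊕ g)
    10⊕-avoids⁺ av = record
      { injective = inj ; fishburn = fish ; no321 = n321 ; no3124 = n3124 }
      where
      open Avoids av
      inj : ∀ {i j} → (10⊕ g) i ≡ (10⊕ g) j → i ≡ j
      inj {0F}          {0F}          _    = refl
      inj {1F}          {1F}          _    = refl
      inj {suc (suc i)} {suc (suc j)} p    = cong (2 Fin.↑ʳ_) (injective (ℕₚ.suc-injective (ℕₚ.suc-injective p)))
      inj {0F}          {1F}          ()
      inj {0F}          {suc (suc _)} ()
      inj {1F}          {0F}          ()
      inj {1F}          {suc (suc _)} ()
      inj {suc (suc _)} {0F}          ()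
      inj {suc (suc _)} {1F}          ()
      fish : ∀ {i j k} → toℕ j ≡ suc (toℕ i) → j Fin.< k → (10⊕ g) i ≡ suc ((10⊕ g) k) → ¬ (10⊕ g) i < (10⊕ g) j
      fish {0F} {1F} _ _ _ ()
      fish {suc (suc i)} {suc (suc j)} {suc (suc k)} p (s<s (s<s q)) r (s<s (s<s s)) =
        fishburn (ℕₚ.suc-injective (ℕₚ.suc-injective p)) q (ℕₚ.suc-injective (ℕₚ.suc-injective r)) s
      n321 : ∀ {i j k} → i Fin.< j → j Fin.< k → (10⊕ g) k < (10⊕ g) j → ¬ (10⊕ g) j < (10⊕ g) i
      n321 {0F} {1F} _ _ ()
      n321 {0F} {suc (suc _)} _ _ _ (s<s ())
      n321 {1F} {suc (suc _)} _ _ _ ()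
      n321 {suc (suc i)} {suc (suc j)} {suc (suc k)} (s<s (s<s p)) (s<s (s<s q)) (s<s (s<s r)) (s<s (s<s s)) =
        no321 p q r s
      n321 {suc (suc _)} {1F} (s<s ())
      n321 {1F} {1F} (s<s ())
      n321 {suc (suc _)} {suc (suc _)} {1F} _ (s<s ())
      n3124 : ∀ {i j k l} → i Fin.< j → j Fin.< k → k Fin.< l →
              (10⊕ g) j < (10⊕ g) k → (10⊕ g) k < (10⊕ g) i → ¬ (10⊕ g) i < (10⊕ g) l
      n3124 {0F} {suc _} {suc (suc _)} _ _ _ _ (s<s ())
      n3124 {0F} {suc _} {1F} _ (s<s ())
      n3124 {1F} _ _ _ _ ()
      n3124 {suc (suc i)} {suc (suc j)} {suc (suc k)} {suc (suc l)}
            (s<s (s<s p)) (s<s (s<s q)) (s<s (s<s r)) (s<s (s<s s)) (s<s (s<s t)) (s<s (s<s u)) =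
        no3124 p q r s t u
      n3124 {suc (suc _)} {1F} (s<s ())
      n3124 {suc (suc _)} {suc (suc _)} {1F} _ (s<s ())
      n3124 {suc (suc _)} {suc (suc _)} {suc (suc _)} {1F} _ _ (s<s ())

    10⊕-avoids⁻ : Avoids (10⊕ g) → Avoids g
    10⊕-avoids⁻ av = record
      { injective = Finₚ.suc-injective ∘ Finₚ.suc-injective ∘ injective ∘ cong (2 +_)
      ; fishburn  = λ p q r s → fishburn (cong (2 +_) p) (s<s (s<s q)) (cong (2 +_) r) (s<s (s<s s))
      ; no321     = λ p q r s → no321 (s<s (s<s p)) (s<s (s<s q)) (s<s (s<s r)) (s<s (s<s s))
      ; no3124    = λ p q r s t u → no3124 (s<s (s<s p)) (s<s (s<s q)) (s<s (s<s r))
                                      (s<s (s<s s)) (s<s (s<s t)) (s<s (s<s u))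
      }
      where open Avoids av

  map-injective : ∀ {a b} {A : Set a} {B : Set b} {f : A → B} → Injective _≡_ _≡_ f →
                  {xs ys : Vec A n} → map f xs ≡ map f ys → xs ≡ ys
  map-injective inj {[]}     {[]}     _  = refl
  map-injective inj {x ∷ xs} {y ∷ ys} eq with fx≡fy , eq′ ← ∷-injective eq
    with refl ← inj fx≡fy | refl ← map-injective inj {xs} {ys} eq′ = refl

  map-preimage : ∀ {a b} {A : Set a} {B : Set b} (f : A → B) (ys : Vec B n) →
                 (∀ i → ∃ λ x → lookup ys i ≡ f x) → ∃ λ xs → ys ≡ map f xs
  map-preimage f []       _ = [] , refl
  map-preimage f (y ∷ ys) h with x , refl ← h zero | xs , refl ← map-preimage f ys (h ∘ suc) = x ∷ xs , refl

  injective⇒surjective : {f : Fin n → Fin n} → Injective _≡_ _≡_ f → ∀ v → ∃ λ i → f i ≡ v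
  injective⇒surjective {n = suc n} {f} inj v with Finₚ.any? (λ i → f i Finₚ.≟ v)
  ... | yes hit  = hit
  ... | no  miss = contradiction (Finₚ.injective⇒≤ punched-injective) ℕₚ.1+n≰n
    where
    punched : Fin (suc n) → Fin n
    punched i = Fin.punchOut {i = v} {f i} λ v≡fi → miss (i , sym v≡fi)
    punched-injective : Injective _≡_ _≡_ punched
    punched-injective = inj ∘ Finₚ.punchOut-injective {i = v} _ _

  value-surjective : (w : Vec (Fin n) n) → Avoids (value w) → ∀ {v} → v < n → ∃ λ i → value w i ≡ v
  value-surjective _ av v<n
    with i , eq ← injective⇒surjective (Avoids.injective av ∘ cong toℕ) (fromℕ< v<n)
    = i , trans (cong toℕ eq) (Finₚ.toℕ-fromℕ< v<n)

  increasing-lower : ∀ {b} (f : Fin n → ℕ) → (∀ {i j} → i Fin.< j → f i < f j) →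
                     (∀ i → b ≤ f i) → ∀ i → b + toℕ i ≤ f i
  increasing-lower {b = b} f mono b≤f zero    = subst (_≤ f zero) (sym (ℕₚ.+-identityʳ b)) (b≤f zero)
  increasing-lower {b = b} f mono b≤f (suc i) = subst (_≤ f (suc i)) (sym (ℕₚ.+-suc b (toℕ i)))
    (increasing-lower (f ∘ suc) (mono ∘ s<s) (λ j → ℕₚ.≤-<-trans (b≤f zero) (mono z<s)) i)

  increasing-upper : ∀ {b} (f : Fin n → ℕ) → (∀ {i j} → i Fin.< j → f i < f j) →
                     (∀ i → f i < b) → ∀ i → f i + (n ∸ toℕ i) ≤ b
  increasing-upper {n = suc n} {b} f mono f<b zero = begin
    f zero + suc n                  ≡⟨ ℕₚ.+-suc (f zero) n ⟩
    suc (f zero + n)                ≡⟨ cong (λ k → suc (f zero + k)) (Finₚ.toℕ-fromℕ n) ⟨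
    suc (f zero + toℕ (fromℕ n))    ≤⟨ s≤s (increasing-lower f mono f₀≤f (fromℕ n)) ⟩
    suc (f (fromℕ n))               ≤⟨ f<b (fromℕ n) ⟩
    b                               ∎
    where
    open ℕₚ.≤-Reasoning
    f₀≤f : ∀ i → f zero ≤ f i
    f₀≤f zero    = ℕₚ.≤-refl
    f₀≤f (suc i) = ℕₚ.<⇒≤ (mono z<s)
  increasing-upper f mono f<b (suc i) = increasing-upper (f ∘ suc) (mono ∘ s<s) (f<b ∘ suc) i

  increasing⇒toℕ : (f : Fin n → ℕ) → (∀ {i j} → i Fin.< j → f i < f j) →
                   (∀ i → f i < n) → ∀ i → f i ≡ toℕ i
  increasing⇒toℕ {n} f mono f<n i = ℕₚ.≤-antisym
    (ℕₚ.+-cancelʳ-≤ (n ∸ toℕ i) (f i) (toℕ i)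
      (subst (f i + (n ∸ toℕ i) ≤_) (sym (ℕₚ.m+[n∸m]≡n (Finₚ.toℕ≤n i))) (increasing-upper f mono f<n i)))
    (increasing-lower f mono (λ _ → z≤n) i)

  -- Entry k m a v: the word k+2, 0, k+3, …, k+m+2, 1, …, k+1 has value v at position a.
  data Entry (k m : ℕ) : ℕ → ℕ → Set where
    head  : Entry k m 0 (2 + k)
    low   : Entry k m 1 0
    big   : ∀ {i v} → i < m → v ≡ k + i → Entry k m (2 + i) (3 + v)
    small : ∀ {i a} → i ≤ k → a ≡ m + i → Entry k m (2 + a) (1 + i)

  module _ {k m : ℕ} where

    value<size : ∀ {a v} → Entry k m a v → v < 3 + k + m
    value<size head           = s≤s (s≤s (s≤s (ℕₚ.m≤m+n k m)))
    value<size low            = z<s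
    value<size (big i<m refl) = s<s (s<s (s<s (ℕₚ.+-monoʳ-< k i<m)))
    value<size (small i≤k _)  = s<s (s<s (ℕₚ.m≤n⇒m≤1+n (ℕₚ.≤-trans i≤k (ℕₚ.m≤m+n k m))))

    position<size : ∀ {a v} → Entry k m a v → a < 3 + k + m
    position<size head             = z<s
    position<size low              = s<s z<s
    position<size (big i<m _)      = s<s (s<s (ℕₚ.m≤n⇒m≤1+n (ℕₚ.≤-trans i<m (ℕₚ.m≤n+m m k))))
    position<size (small i≤k refl) = s<s (s<s (s≤s (ℕₚ.≤-trans (ℕₚ.+-monoʳ-≤ m i≤k) (ℕₚ.≤-reflexive (ℕₚ.+-comm m k)))))

    entry-at : ∀ a → a < 3 + k + m → ∃ λ v → Entry k m a v
    entry-at 0             _                   = _ , head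
    entry-at 1             _                   = _ , low
    entry-at (suc (suc i)) (s<s (s<s (s≤s i≤k+m))) with i ℕₚ.<? m
    ... | yes i<m = _ , big i<m refl
    ... | no  i≮m = _ , small
      (ℕₚ.m≤n+o⇒m∸n≤o i m (subst (i ≤_) (ℕₚ.+-comm k m) i≤k+m))
      (sym (ℕₚ.m+[n∸m]≡n (ℕₚ.≮⇒≥ i≮m)))

    entry-of : ∀ v → v < 3 + k + m → ∃ λ a → Entry k m a v
    entry-of zero    _ = _ , low
    entry-of (suc v) (s<s v<) with ℕₚ.<-cmp v (suc k)
    ... | tri< (s≤s v≤k) _ _ = _ , small v≤k refl
    ... | tri≈ _ refl _      = _ , head
    entry-of (suc (suc (suc v))) (s<s (s<s (s<s v<))) | tri> _ _ (s<s (s≤s k≤v)) = _ , big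
      (ℕₚ.+-cancelˡ-< k _ m (subst (_< k + m) (sym (ℕₚ.m+[n∸m]≡n k≤v)) v<))
      (sym (ℕₚ.m+[n∸m]≡n k≤v))

    entry-functional : ∀ {a v v′} → Entry k m a v → Entry k m a v′ → v ≡ v′
    entry-functional head          head           = refl
    entry-functional low           low            = refl
    entry-functional (big _ refl)  (big _ refl)   = refl
    entry-functional (big i<m _)   (small _ refl) = contradiction (ℕₚ.<-≤-trans i<m (ℕₚ.m≤m+n m _)) (ℕₚ.<-irrefl refl)
    entry-functional (small _ refl) (big i<m _)   = contradiction (ℕₚ.<-≤-trans i<m (ℕₚ.m≤m+n m _)) (ℕₚ.<-irrefl refl)
    entry-functional (small _ refl) (small _ eq)  = cong suc (ℕₚ.+-cancelˡ-≡ m _ _ eq)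

    entry-injective : ∀ {a a′ v} → Entry k m a v → Entry k m a′ v → a ≡ a′
    entry-injective head             head             = refl
    entry-injective head             (big _ eq)       = contradiction eq (ℕₚ.m≢1+m+n _)
    entry-injective head             (small k<k _)    = contradiction k<k ℕₚ.1+n≰n
    entry-injective low              low              = refl
    entry-injective (big _ eq)       head             = contradiction eq (ℕₚ.m≢1+m+n _)
    entry-injective (big _ refl)     (big _ eq)       = cong (2 +_) (ℕₚ.+-cancelˡ-≡ k _ _ eq)
    entry-injective (big _ refl)     (small v<k _)    = contradiction (ℕₚ.<⇒≤ v<k) (ℕₚ.m+n≮m k _)
    entry-injective (small k<k _)    head             = contradiction k<k ℕₚ.1+n≰n
    entry-injective (small v<k _)    (big _ refl)     = contradiction (ℕₚ.<⇒≤ v<k) (ℕₚ.m+n≮m k _)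
    entry-injective (small _ refl)   (small _ refl)   = refl

    descent-from : ∀ {a b u v} → Entry k m a u → Entry k m b v → a < b → v < u → 2 + k ≤ u
    descent-from head           _              _   _   = ℕₚ.≤-refl
    descent-from (big _ refl)   _              _   _   = s≤s (s≤s (ℕₚ.m≤n⇒m≤1+n (ℕₚ.m≤m+n k _)))
    descent-from (small _ _)    low            (s<s ()) _
    descent-from (small i≤k _)  head           ()  _
    descent-from (small _ refl) (big j<m _)    a<b _   =
      contradiction (ℕₚ.<-trans (s<s⁻¹ (s<s⁻¹ a<b)) j<m) (ℕₚ.m+n≮m m _)
    descent-from (small _ refl) (small _ refl) a<b v<u =
      contradiction (ℕₚ.+-cancelˡ-< m _ _ (s<s⁻¹ (s<s⁻¹ a<b))) (ℕₚ.<-asym (s<s⁻¹ v<u))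

    descent-to : ∀ {a b u v} → Entry k m a u → Entry k m b v → a < b → v < u → v < 2 + k
    descent-to _              low            _   _   = z<s
    descent-to _              (small i≤k _)  _   _   = s<s (s<s i≤k)
    descent-to head           (big _ refl)   _   v<u =
      contradiction (ℕₚ.<⇒≤ (s<s⁻¹ (s<s⁻¹ v<u))) (ℕₚ.m+n≮m k _)
    descent-to (big _ refl)   (big _ refl)   a<b v<u =
      contradiction (ℕₚ.+-cancelˡ-< k _ _ (s<s⁻¹ (s<s⁻¹ (s<s⁻¹ v<u)))) (ℕₚ.<-asym (s<s⁻¹ (s<s⁻¹ a<b)))
    descent-to (small i≤k _)  (big _ refl)   _   v<u =
      contradiction (ℕₚ.<⇒≤ (ℕₚ.<⇒≤ (ℕₚ.<-≤-trans (s<s⁻¹ v<u) i≤k))) (ℕₚ.m+n≮m k _)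

    big-before-small : ∀ {a b u v} → Entry k m a u → Entry k m b v → 2 ≤ a → a < b → u < 2 + k → ¬ 2 + k < v
    big-before-small _              head           _        _   _   v>K = contradiction v>K (ℕₚ.<-irrefl refl)
    big-before-small _              (small i≤k _)  _        _   _   v>K =
      contradiction (s<s⁻¹ (s<s⁻¹ (ℕₚ.m≤n⇒m≤1+n v>K))) (ℕₚ.≤⇒≯ i≤k)
    big-before-small low            _              (s≤s ()) _   _   _
    big-before-small (big _ refl)   (big _ _)      _        _   u<K _   =
      contradiction (ℕₚ.<⇒≤ (s<s⁻¹ (s<s⁻¹ u<K))) (ℕₚ.m+n≮m k _)
    big-before-small (small _ refl) (big i<m _)    _        a<b _   _   =
      contradiction (ℕₚ.<-trans (s<s⁻¹ (s<s⁻¹ a<b)) i<m) (ℕₚ.m+n≮m m _)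

    big-is-record : ∀ {a b u v} → Entry k m a u → Entry k m b (3 + v) → a < b → k ≤ v → u < 3 + v
    big-is-record {u = u} {v} e e′ a<b k≤v with ℕₚ.<-cmp u (3 + v)
    ... | tri< u<v _ _ = u<v
    ... | tri≈ _ refl _ = contradiction a<b (ℕₚ.<-irrefl (entry-injective e e′))
    ... | tri> _ _ v<u = contradiction (descent-to e e′ a<b v<u) (ℕₚ.≤⇒≯ (s≤s (s≤s (ℕₚ.m≤n⇒m≤1+n k≤v))))

    entry⇒avoids : {g : Fin n → ℕ} → (∀ i → Entry k m (toℕ i) (g i)) → Avoids g
    entry⇒avoids {g = g} entry = record
      { injective = λ {i} {j} gi≡gj →
          Finₚ.toℕ-injective (entry-injective (entry i) (subst (Entry k m (toℕ j)) (sym gi≡gj) (entry j)))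
      ; fishburn  = λ {i} {j} {l} j≡1+i j<l gi≡1+gl gi<gj →
          let i<l   = ℕₚ.<-trans (ℕₚ.≤-reflexive (sym j≡1+i)) j<l
              gl<gi = ℕₚ.≤-reflexive (sym gi≡1+gl)
              gi≡K  = ℕₚ.≤-antisym
                (subst (_≤ 2 + k) (sym gi≡1+gl) (descent-to (entry i) (entry l) i<l gl<gi))
                (descent-from (entry i) (entry l) i<l gl<gi)
              i≡0   = entry-injective (subst (Entry k m (toℕ i)) gi≡K (entry i)) head
              gj≡0  = entry-functional (subst (λ a → Entry k m a (g j)) (trans j≡1+i (cong suc i≡0)) (entry j)) low
          in ℕₚ.n≮0 (subst (g i <_) gj≡0 gi<gj)
      ; no321     = λ {i} {j} {l} i<j j<l gl<gj gj<gi →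
          ℕₚ.<⇒≱ (descent-to (entry i) (entry j) i<j gj<gi) (descent-from (entry j) (entry l) j<l gl<gj)
      ; no3124    = λ {i} {j} {l} {o} i<j j<l l<o gj<gl gl<gi gi<go →
          let i<l = ℕₚ.<-trans i<j j<l in
          big-before-small (entry l) (entry o) (ℕₚ.≤-trans (s≤s (ℕₚ.≤-trans (s≤s z≤n) i<j)) j<l) l<o
            (descent-to (entry i) (entry l) i<l gl<gi)
            (ℕₚ.≤-<-trans (descent-from (entry i) (entry l) i<l gl<gi) gi<go)
      }

  -- The number of values of Fin (2 + n) above 2 + c.
  above : Fin n → ℕ
  above {n} c = n ∸ suc (toℕ c)

  size : (c : Fin n) → 3 + toℕ c + above c ≡ 2 + n
  size c = cong (2 +_) (ℕₚ.m+[n∸m]≡n (Finₚ.toℕ<n c))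

  headed-at : (c : Fin n) (i : Fin (2 + n)) → ∃ λ v → Entry (toℕ c) (above c) (toℕ i) (toℕ {2 + n} v)
  headed-at c i
    with v , e ← entry-at {toℕ c} {above c} (toℕ i) (subst (toℕ i <_) (sym (size c)) (Finₚ.toℕ<n i))
    = fromℕ< v<2+n , subst (Entry _ _ (toℕ i)) (sym (Finₚ.toℕ-fromℕ< v<2+n)) e
    where v<2+n = subst (v <_) (size c) (value<size e)

  headed : Fin n → Vec (Fin (2 + n)) (2 + n)
  headed c = tabulate (proj₁ ∘ headed-at c)

  headed-entry : (c : Fin n) → ∀ i → Entry (toℕ c) (above c) (toℕ i) (value (headed c) i)
  headed-entry c i = subst (Entry _ _ (toℕ i))
    (cong toℕ (sym (lookup∘tabulate (proj₁ ∘ headed-at c) i))) (proj₂ (headed-at c i))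

  headed-head : (c : Fin n) → lookup (headed c) zero ≡ suc (suc c)
  headed-head c = Finₚ.toℕ-injective (entry-functional (headed-entry c zero) head)

  module _ {w : Vec (Fin (2 + n)) (2 + n)} (av : Avoids (value w)) where

    open Avoids av

    smalls-increase : ∀ {c : Fin (suc n)} → lookup w zero ≡ suc c → ∀ {i j} → i Fin.< j →
      value w i < suc (toℕ c) → value w j < suc (toℕ c) → value w i < value w j
    smalls-increase head≡ {zero} {j} _ wi<w0 _ = contradiction wi<w0 (ℕₚ.<-irrefl (cong toℕ head≡))
    smalls-increase head≡ {i@(suc _)} {j} i<j wi<w0 _ with ℕₚ.<-cmp (value w i) (value w j)
    ... | tri< lt _ _ = lt
    ... | tri≈ _ eq _ = contradiction i<j (ℕₚ.<-irrefl (cong toℕ (injective eq)))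
    ... | tri> _ _ gt = contradiction (subst (value w i <_) (sym (cong toℕ head≡)) wi<w0) (no321 {zero} z<s i<j gt)

    second≡0 : ∀ {c : Fin (suc n)} → lookup w zero ≡ suc c → value w 1F ≡ 0
    second≡0 {c} head≡ = at-zero
      where
      w1<w0 : value w 1F < suc (toℕ c)
      w1<w0 with ℕₚ.<-cmp (value w 1F) (suc (toℕ c))
      ... | tri< lt _ _ = lt
      ... | tri≈ _ eq _ = contradiction (injective (trans eq (sym (cong toℕ head≡)))) λ ()
      ... | tri> _ _ gt with value-surjective w av {toℕ c} (ℕₚ.<-trans (Finₚ.toℕ<n c) (ℕₚ.n<1+n _))
      ...   | zero        , eq = contradiction (trans (sym eq) (cong toℕ head≡)) (ℕₚ.1+n≢n ∘ sym)
      ...   | 1F          , eq = contradiction (ℕₚ.<-trans (ℕₚ.n<1+n _) gt) (ℕₚ.<-irrefl (sym eq))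
      ...   | suc (suc p) , eq = contradiction (subst (_< value w 1F) (sym (cong toℕ head≡)) gt)
              (fishburn {0F} {1F} {suc (suc p)} refl (s<s z<s) (trans (cong toℕ head≡) (cong suc (sym eq))))
      at-zero : value w 1F ≡ 0
      at-zero with value-surjective w av {0} z<s
      ... | zero        , eq = contradiction (trans (sym eq) (cong toℕ head≡)) λ ()
      ... | 1F          , eq = eq
      ... | suc (suc q) , eq = contradiction
            (smalls-increase head≡ {1F} {suc (suc q)} (s<s z<s) w1<w0 (subst (_< suc (toℕ c)) (sym eq) z<s))
            (ℕₚ.n≮0 ∘ subst (value w 1F <_) eq)

    module _ {c : Fin n} (head≡ : lookup w zero ≡ suc (suc c)) where

      private
        K = 2 + toℕ c

        w0≡K : value w zero ≡ K
        w0≡K = cong toℕ head≡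

        w1≡0 : value w 1F ≡ 0
        w1≡0 = second≡0 head≡

        smalls : ∀ {i j} → i Fin.< j → value w i < K → value w j < K → value w i < value w j
        smalls = smalls-increase head≡

        one : ∃ λ q → value w (suc (suc q)) ≡ 1
        one with value-surjective w av {1} (s<s z<s)
        ... | zero        , eq = contradiction (trans (sym eq) w0≡K) λ ()
        ... | 1F          , eq = contradiction (trans (sym eq) w1≡0) λ ()
        ... | suc (suc q) , eq = q , eq

        q : Fin (2 + n)
        q = suc (suc (proj₁ one))

        wq≡1 : value w q ≡ 1
        wq≡1 = proj₂ one

        no-small-before-big : ∀ {i j} → 2 ≤ toℕ i → i Fin.< j → value w i < K → ¬ K < value w j
        no-small-before-big {i} {j} 2≤i i<j wi<K K<wj = no3124 {zero} {1F} {q} {j} z<s (s<s z<s)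
          (ℕₚ.≤-<-trans q≤i i<j)
          (subst₂ _<_ (sym w1≡0) (sym wq≡1) z<s)
          (subst₂ _<_ (sym wq≡1) (sym w0≡K) (s<s z<s))
          (subst (_< value w j) (sym w0≡K) K<wj)
          where
          q≤i : toℕ q ≤ toℕ i
          q≤i = ℕₚ.≮⇒≥ λ i<q →
            let wi<1 = subst (value w i <_) wq≡1 (smalls i<q wi<K (subst (_< K) (sym wq≡1) (s<s z<s)))
                i≡1  = injective (trans (ℕₚ.n<1⇒n≡0 wi<1) (sym w1≡0))
            in ℕₚ.<-irrefl (sym (cong toℕ i≡1)) 2≤i

        bigs : ∀ {i j} → i Fin.< j → K < value w i → K < value w j → value w i < value w j
        bigs {i} {j} i<j K<wi K<wj with ℕₚ.<-cmp (value w i) (value w j) | ℕₚ.<-cmp (toℕ j) (toℕ q)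
        ... | tri< lt _ _ | _ = lt
        ... | tri≈ _ eq _ | _ = contradiction i<j (ℕₚ.<-irrefl (cong toℕ (injective eq)))
        ... | tri> _ _ gt | tri< j<q _ _ =
          contradiction gt (no321 i<j j<q (subst (_< value w j) (sym wq≡1) (ℕₚ.<-trans (s<s z<s) K<wj)))
        ... | tri> _ _ gt | tri≈ _ j≡q _ = contradiction
          (subst (K <_) (trans (cong (value w) (Finₚ.toℕ-injective j≡q)) wq≡1) K<wj) λ { (s≤s ()) }
        ... | tri> _ _ gt | tri> _ _ q<j =
          contradiction K<wj (no-small-before-big (s≤s (s≤s z≤n)) q<j (subst (_< K) (sym wq≡1) (s<s z<s)))

        -- The positions prescribed by Entry for the values of w increase from left to
        -- right, so they are the actual positions.
        order : ∀ {i j a b u v} → value w i ≡ u → value w j ≡ v → i Fin.< j →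
                Entry (toℕ c) (above c) a u → Entry (toℕ c) (above c) b v → a < b
        order {i} {j} _ wj i<j _ head with refl ← injective {j} {zero} (trans wj (sym w0≡K)) =
          contradiction i<j ℕₚ.n≮0
        order {zero} {1F} {u = u} wi wj i<j e low =
          subst (_< 1) (entry-injective head (subst (Entry _ _ _) (trans (sym wi) w0≡K) e)) z<s
        order {i} {suc (suc j)} _ wj i<j _ low =
          contradiction (injective {suc (suc j)} {1F} (trans wj (sym w1≡0))) λ ()
        order {suc i} {1F} _ _ (s<s ()) _ low
        order _ _ _ head (big _ _) = z<s
        order _ _ _ head (small _ _) = z<s
        order _ _ _ low (big _ _) = s<s z<s
        order _ _ _ low (small _ _) = s<s z<s
        order wi wj i<j (big _ refl) (big _ refl) = s<s (s<s (ℕₚ.+-cancelˡ-< (toℕ c) _ _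
          (s<s⁻¹ (s<s⁻¹ (s<s⁻¹ (subst₂ _<_ wi wj (bigs i<j
            (subst (K <_) (sym wi) (s≤s (s≤s (s≤s (ℕₚ.m≤m+n _ _)))))
            (subst (K <_) (sym wj) (s≤s (s≤s (s≤s (ℕₚ.m≤m+n _ _))))))))))))
        order _ _ _ (big i<m _) (small _ refl) = s<s (s<s (ℕₚ.<-≤-trans i<m (ℕₚ.m≤m+n _ _)))
        order {zero} wi _ _ (small k<k _) (big _ _) with refl ← trans (sym w0≡K) wi =
          contradiction k<k ℕₚ.1+n≰n
        order {1F} wi _ _ (small _ _) (big _ _) = contradiction (trans (sym w1≡0) wi) λ ()
        order {suc (suc i)} wi wj i<j (small i≤k _) (big _ refl) = contradiction
          (subst (K <_) (sym wj) (s≤s (s≤s (s≤s (ℕₚ.m≤m+n _ _)))))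
          (no-small-before-big (s≤s (s≤s z≤n)) i<j (subst (_< K) (sym wi) (s<s (s<s i≤k))))
        order wi wj i<j (small i≤k refl) (small j≤k refl) = s<s (s<s (ℕₚ.+-monoʳ-< (above c)
          (s<s⁻¹ (subst₂ _<_ wi wj (smalls i<j
            (subst (_< K) (sym wi) (s<s (s<s i≤k))) (subst (_< K) (sym wj) (s<s (s<s j≤k))))))))

        position : ∀ i → ∃ λ a → Entry (toℕ c) (above c) a (value w i)
        position i = entry-of (value w i) (subst (value w i <_) (sym (size c)) (Finₚ.toℕ<n (lookup w i)))

        position≡ : ∀ i → proj₁ (position i) ≡ toℕ i
        position≡ = increasing⇒toℕ (proj₁ ∘ position)
          (λ {i} {j} i<j → order refl refl i<j (proj₂ (position i)) (proj₂ (position j)))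
          (λ i → subst (proj₁ (position i) <_) (size c) (position<size (proj₂ (position i))))

      headed-unique : w ≡ headed c
      headed-unique = trans (sym (tabulate∘lookup w)) (tabulate-cong {f = lookup w} {g = proj₁ ∘ headed-at c} λ i →
        Finₚ.toℕ-injective
        (entry-functional (subst (λ a → Entry _ _ a (value w i)) (position≡ i) (proj₂ (position i)))
                          (proj₂ (headed-at c i))))

  head≡0⇒0⊕ : {w : Vec (Fin (suc n)) (suc n)} → Avoids (value w) → lookup w zero ≡ zero → ∃ λ u → w ≡ 0⊕ᵛ u
  head≡0⇒0⊕ {w = zero ∷ ys} av refl =
    let u , ys≡ = map-preimage suc ys nonzero in u , cong (zero ∷_) ys≡
    where
    nonzero : ∀ i → ∃ λ v → lookup ys i ≡ suc v
    nonzero i with lookup ys i in eq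
    ... | zero  = contradiction (Avoids.injective av {zero} {suc i} (cong toℕ (sym eq))) λ ()
    ... | suc v = v , refl

  head≡1⇒10⊕ : {w : Vec (Fin (2 + n)) (2 + n)} → Avoids (value w) → lookup w zero ≡ 1F → ∃ λ u → w ≡ 10⊕ᵛ u
  head≡1⇒10⊕ {w = _ ∷ y ∷ ys} av refl =
    let u , ys≡ = map-preimage (2 Fin.↑ʳ_) ys large
    in u , cong₂ (λ z zs → 1F ∷ z ∷ zs) (Finₚ.toℕ-injective y≡0) ys≡
    where
    y≡0 : toℕ y ≡ 0
    y≡0 = second≡0 {w = 1F ∷ y ∷ ys} av {zero} refl
    large : ∀ i → ∃ λ v → lookup ys i ≡ 2 Fin.↑ʳ v
    large i with lookup ys i in eq
    ... | 0F          = contradiction (Avoids.injective av {1F} {suc (suc i)} (trans y≡0 (cong toℕ (sym eq)))) λ ()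
    ... | 1F          = contradiction (Avoids.injective av {0F} {suc (suc i)} (cong toℕ (sym eq))) λ ()
    ... | suc (suc v) = v , refl

  0⊕-InF⁺ : {w : Vec (Fin n) n} → InF w → InF (0⊕ᵛ w)
  0⊕-InF⁺ {w = w} = Avoids⇒InF ∘ avoids-resp-≗ (sym ∘ value-0⊕ w) ∘ 0⊕-avoids⁺ ∘ InF⇒Avoids

  0⊕-InF⁻ : {w : Vec (Fin n) n} → InF (0⊕ᵛ w) → InF w
  0⊕-InF⁻ {w = w} = Avoids⇒InF ∘ 0⊕-avoids⁻ ∘ avoids-resp-≗ (value-0⊕ w) ∘ InF⇒Avoids

  10⊕-InF⁺ : {w : Vec (Fin n) n} → InF w → InF (10⊕ᵛ w)
  10⊕-InF⁺ {w = w} = Avoids⇒InF ∘ avoids-resp-≗ (sym ∘ value-10⊕ w) ∘ 10⊕-avoids⁺ ∘ InF⇒Avoids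

  10⊕-InF⁻ : {w : Vec (Fin n) n} → InF (10⊕ᵛ w) → InF w
  10⊕-InF⁻ {w = w} = Avoids⇒InF ∘ 10⊕-avoids⁻ ∘ avoids-resp-≗ (value-10⊕ w) ∘ InF⇒Avoids

  headed-InF : (c : Fin n) → InF (headed c)
  headed-InF c = Avoids⇒InF (entry⇒avoids (headed-entry c))

  ∈F⁺ : {w : Vec (Fin n) n} → InF w → w ∈ F n
  ∈F⁺ = ∈-filter⁺ inF? (∈-words _)

  ∈F⁻ : {w : Vec (Fin n) n} → w ∈ F n → InF w
  ∈F⁻ {n} = proj₂ ∘ ∈-filter⁻ inF? {xs = words n n}

  F-unique : ∀ n → ListUnique.Unique (F n)
  F-unique n = ListUniqueₚ.filter⁺ inF? (words-unique n n)

  F-by-head : ∀ n → List (Vec (Fin (2 + n)) (2 + n))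
  F-by-head n = List.map 0⊕ᵛ_ (F (suc n)) ++ List.map 10⊕ᵛ_ (F n) ++ List.map headed (allFin n)

  F-by-head-unique : ∀ n → ListUnique.Unique (F-by-head n)
  F-by-head-unique n =
    ListUniqueₚ.++⁺ (ListUniqueₚ.map⁺ (map-injective Finₚ.suc-injective ∘ ∷-injectiveʳ) (F-unique (suc n)))
      (ListUniqueₚ.++⁺
        (ListUniqueₚ.map⁺ (map-injective (Finₚ.↑ʳ-injective 2 _ _) ∘ ∷-injectiveʳ ∘ ∷-injectiveʳ) (F-unique n))
        (ListUniqueₚ.map⁺ headed-injective (ListUniqueₚ.allFin⁺ n))
        (λ (p , q) → 10⊕≢headed (∈-map⁻ 10⊕ᵛ_ p) (∈-map⁻ headed q)))
      (λ (p , q) → [ 0⊕≢10⊕ (∈-map⁻ 0⊕ᵛ_ p) ∘ ∈-map⁻ 10⊕ᵛ_ , 0⊕≢headed (∈-map⁻ 0⊕ᵛ_ p) ∘ ∈-map⁻ headed ]′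
        (∈-++⁻ (List.map 10⊕ᵛ_ (F n)) q))
    where
    headed-injective : {c d : Fin n} → headed c ≡ headed d → c ≡ d
    headed-injective {c} {d} eq = Finₚ.suc-injective (Finₚ.suc-injective
      (trans (sym (headed-head c)) (trans (cong (λ w → lookup w zero) eq) (headed-head d))))
    10⊕≢headed : ∀ {w} → (∃ λ u → u ∈ F n × w ≡ 10⊕ᵛ u) → ¬ (∃ λ c → c ∈ allFin n × w ≡ headed c)
    10⊕≢headed (_ , _ , refl) (c , _ , eq) =
      contradiction (trans (cong (λ w → lookup w zero) eq) (headed-head c)) (Finₚ.0≢1+n ∘ Finₚ.suc-injective)
    0⊕≢10⊕ : ∀ {w} → (∃ λ u → u ∈ F (suc n) × w ≡ 0⊕ᵛ u) → ¬ (∃ λ u → u ∈ F n × w ≡ 10⊕ᵛ u)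
    0⊕≢10⊕ (_ , _ , refl) (_ , _ , ())
    0⊕≢headed : ∀ {w} → (∃ λ u → u ∈ F (suc n) × w ≡ 0⊕ᵛ u) → ¬ (∃ λ c → c ∈ allFin n × w ≡ headed c)
    0⊕≢headed (_ , _ , refl) (c , _ , eq) =
      contradiction (trans (cong (λ w → lookup w zero) eq) (headed-head c)) Finₚ.0≢1+n

  F↭F-by-head : ∀ n → F (2 + n) ↭ F-by-head n
  F↭F-by-head n = ∼bag⇒↭ (unique∧set⇒bag (F-unique (2 + n)) (F-by-head-unique n) (mk⇔ (split ∘ ∈F⁻) (∈F⁺ ∘ join)))
    where
    split-at : ∀ {w} v → lookup w zero ≡ v → InF w → w ∈ F-by-head n
    split-at {w} zero eq w∈F =
      let u , w≡ = head≡0⇒0⊕ {w = w} (InF⇒Avoids w∈F) eq in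
      subst (_∈ F-by-head n) (sym w≡) (∈-++⁺ˡ (∈-map⁺ 0⊕ᵛ_ (∈F⁺ (0⊕-InF⁻ (subst InF w≡ w∈F)))))
    split-at {w} (suc zero) eq w∈F =
      let u , w≡ = head≡1⇒10⊕ {w = w} (InF⇒Avoids w∈F) eq in
      subst (_∈ F-by-head n) (sym w≡)
        (∈-++⁺ʳ (List.map 0⊕ᵛ_ (F (suc n))) (∈-++⁺ˡ (∈-map⁺ 10⊕ᵛ_ (∈F⁺ (10⊕-InF⁻ (subst InF w≡ w∈F))))))
    split-at {w} (suc (suc c)) eq w∈F =
      subst (_∈ F-by-head n) (sym (headed-unique {w = w} (InF⇒Avoids w∈F) eq))
        (∈-++⁺ʳ (List.map 0⊕ᵛ_ (F (suc n))) (∈-++⁺ʳ (List.map 10⊕ᵛ_ (F n)) (∈-map⁺ headed (∈-allFin c))))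
    split : ∀ {w} → InF w → w ∈ F-by-head n
    split {w} = split-at (lookup w zero) refl
    join : ∀ {w} → w ∈ F-by-head n → InF w
    join w∈ = [ join₀ ∘ ∈-map⁻ 0⊕ᵛ_ , [ join₁₀ ∘ ∈-map⁻ 10⊕ᵛ_ , joinₕ ∘ ∈-map⁻ headed ]′ ∘ ∈-++⁻ (List.map 10⊕ᵛ_ (F n)) ]′
      (∈-++⁻ (List.map 0⊕ᵛ_ (F (suc n))) w∈)
      where
      join₀ : ∀ {w} → (∃ λ u → u ∈ F (suc n) × w ≡ 0⊕ᵛ u) → InF w
      join₀ (_ , u∈F , refl) = 0⊕-InF⁺ (∈F⁻ u∈F)
      join₁₀ : ∀ {w} → (∃ λ u → u ∈ F n × w ≡ 10⊕ᵛ u) → InF w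
      join₁₀ (_ , u∈F , refl) = 10⊕-InF⁺ (∈F⁻ u∈F)
      joinₕ : ∀ {w} → (∃ λ c → c ∈ allFin n × w ≡ headed c) → InF w
      joinₕ (c , _ , refl) = headed-InF c

  length-filter-tabulate :
    ∀ {a b p q} {A : Set a} {B : Set b} {P : Pred A p} {Q : Pred B q} (P? : Decidable P) (Q? : Decidable Q)
    (f : Fin n → A) (g : Fin n → B) → (∀ i → P (f i) ⇔ Q (g i)) →
    length (filter P? (List.tabulate f)) ≡ length (filter Q? (List.tabulate g))
  length-filter-tabulate {n = zero}  P? Q? f g P⇔Q = refl
  length-filter-tabulate {n = suc n} P? Q? f g P⇔Q with P? (f zero) | Q? (g zero)
  ... | yes _ | yes _ = cong suc (length-filter-tabulate P? Q? (f ∘ suc) (g ∘ suc) (P⇔Q ∘ suc))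
  ... | no _  | no _  = length-filter-tabulate P? Q? (f ∘ suc) (g ∘ suc) (P⇔Q ∘ suc)
  ... | yes p | no ¬q = contradiction (Equivalence.to (P⇔Q zero) p) ¬q
  ... | no ¬p | yes q = contradiction (Equivalence.from (P⇔Q zero) q) ¬p

  length-filter-toℕ< : ∀ m {n} → m ≤ n → length (filter (λ i → toℕ i ℕₚ.<? m) (allFin n)) ≡ m
  length-filter-toℕ< zero {zero}  _ = refl
  length-filter-toℕ< zero {suc n} _ = trans
    (length-filter-tabulate {n = n} _ (λ i → toℕ i ℕₚ.<? 0) suc id (λ _ → mk⇔ (λ ()) (λ ())))
    (length-filter-toℕ< zero {n} z≤n)
  length-filter-toℕ< (suc m) {suc n} (s≤s m≤n) = cong suc (trans
    (length-filter-tabulate {n = n} _ (λ i → toℕ i ℕₚ.<? m) suc id (λ _ → mk⇔ s<s⁻¹ s<s))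
    (length-filter-toℕ< m m≤n))

  lrmax-0⊕ : (w : Vec (Fin n) n) → lrmax (0⊕ᵛ w) ≡ suc (lrmax w)
  lrmax-0⊕ {n} w = trans
    (cong length (Listₚ.filter-accept (isLRMax? (0⊕ᵛ w)) {zero} {List.tabulate suc} λ _ ()))
    (cong suc (length-filter-tabulate (isLRMax? (0⊕ᵛ w)) (isLRMax? w) suc id λ i → mk⇔ (to i) (from i)))
    where
    to : ∀ i → IsLRMax (0⊕ᵛ w) (suc i) → IsLRMax w i
    to i max j j<i = s<s⁻¹ (subst₂ _<_ (value-0⊕ w (suc j)) (value-0⊕ w (suc i)) (max (suc j) (s<s j<i)))
    from : ∀ i → IsLRMax w i → IsLRMax (0⊕ᵛ w) (suc i)
    from i max zero    _         = subst (0 <_) (sym (value-0⊕ w (suc i))) z<s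
    from i max (suc j) (s<s j<i) =
      subst₂ _<_ (sym (value-0⊕ w (suc j))) (sym (value-0⊕ w (suc i))) (s<s (max j j<i))

  lrmax-10⊕ : (w : Vec (Fin n) n) → lrmax (10⊕ᵛ w) ≡ suc (lrmax w)
  lrmax-10⊕ {n} w = trans
    (cong length (Listₚ.filter-accept (isLRMax? (10⊕ᵛ w)) {zero} {List.tabulate suc} λ _ ()))
    (cong suc (trans
      (cong length (Listₚ.filter-reject (isLRMax? (10⊕ᵛ w)) {1F} {List.tabulate (2 Fin.↑ʳ_)}
        (λ max → contradiction (max zero z<s) λ ())))
      (length-filter-tabulate (isLRMax? (10⊕ᵛ w)) (isLRMax? w) (2 Fin.↑ʳ_) id λ i → mk⇔ (to i) (from i))))
    where
    to : ∀ i → IsLRMax (10⊕ᵛ w) (suc (suc i)) → IsLRMax w i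
    to i max j j<i = s<s⁻¹ (s<s⁻¹ (subst₂ _<_ (value-10⊕ w (suc (suc j))) (value-10⊕ w (suc (suc i)))
      (max (suc (suc j)) (s<s (s<s j<i)))))
    from : ∀ i → IsLRMax w i → IsLRMax (10⊕ᵛ w) (suc (suc i))
    from i max 0F            _               = subst (1 <_) (sym (value-10⊕ w (suc (suc i)))) (s<s z<s)
    from i max 1F            _               = subst (0 <_) (sym (value-10⊕ w (suc (suc i)))) z<s
    from i max (suc (suc j)) (s<s (s<s j<i)) =
      subst₂ _<_ (sym (value-10⊕ w (suc (suc j)))) (sym (value-10⊕ w (suc (suc i)))) (s<s (s<s (max j j<i)))

  lrmax-headed : (c : Fin n) → lrmax (headed c) ≡ suc (above c)
  lrmax-headed {n} c = trans
    (cong length (Listₚ.filter-accept (isLRMax? (headed c)) {zero} {List.tabulate suc} λ _ ()))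
    (cong suc (trans
      (cong length (Listₚ.filter-reject (isLRMax? (headed c)) {1F} {List.tabulate (2 Fin.↑ʳ_)}
        (λ max → ℕₚ.n≮0 (subst (value w 0F <_) w1≡0 (max zero z<s)))))
      (trans
        (length-filter-tabulate (isLRMax? (headed c)) (λ i → toℕ i ℕₚ.<? above c) (2 Fin.↑ʳ_) id
          λ i → mk⇔ (to i (headed-entry c (suc (suc i)))) (from i))
        (length-filter-toℕ< (above c) (ℕₚ.m∸n≤m n (suc (toℕ c)))))))
    where
    w = headed c
    w1≡0 : value w 1F ≡ 0
    w1≡0 = entry-functional (headed-entry c 1F) low
    w0≡K : value w 0F ≡ 2 + toℕ c
    w0≡K = entry-functional (headed-entry c 0F) head
    to : ∀ i {v} → Entry (toℕ c) (above c) (2 + toℕ i) v → IsLRMax w (suc (suc i)) → toℕ i < above c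
    to i (big i<m _)      _   = i<m
    to i e@(small j≤k _)  max = contradiction
      (subst₂ _<_ w0≡K (entry-functional (headed-entry c (suc (suc i))) e) (max zero z<s))
      (ℕₚ.≤⇒≯ (ℕₚ.m≤n⇒m≤1+n (s≤s j≤k)))
    from : ∀ i → toℕ i < above c → IsLRMax w (suc (suc i))
    from i i<m j j<i = subst (value w j <_) wi≡ (big-is-record (headed-entry c j) (big i<m refl) j<i (ℕₚ.m≤m+n _ _))
      where wi≡ = entry-functional (big i<m refl) (headed-entry c (suc (suc i)))

-- The generating function

module Enumeration {c ℓ} (R : CommutativeRing c ℓ) (s : CommutativeRing.Carrier R) where

  private module R = CommutativeRing R
  open PowerSeries R.rawRing using (Series)
  open PowerSeriesProperties R using (commutativeRing)
  open CommutativeRing commutativeRing using (_≈_; _+_; _*_; 1#; rawRing)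
  open RawSemiringDefinitions (RawRing.rawSemiring rawRing) using (_^_)
  open RawSemiringDefinitions (RawRing.rawSemiring R.rawRing) using () renaming (_^_ to _^ᶜ_)
  open FishburnPermutations
  open ListSum R
  open Recurrences R s

  geometric powers headed-sums fibonacci : Series
  geometric _ = R.1#
  powers n = s ^ᶜ n
  headed-sums n = ∑ (λ c → s ^ᶜ suc (above c)) (allFin n)
  fibonacci 0 = R.1#
  fibonacci 1 = s R.* R.1#
  fibonacci (suc (suc n)) = s R.* fibonacci (suc n) R.+ s R.* fibonacci n

  weight : ∀ {n} → Vec (Fin n) n → R.Carrier
  weight w = s ^ᶜ lrmax w

  lrmax-series : Series
  lrmax-series n = ∑ weight (F n)

  geometric-recurrence : geometric ≈ 1# + x * geometric
  geometric-recurrence = x-recurrence {geometric} {1#} R.refl λ _ → R.sym (R.+-identityˡ _)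

  powers-recurrence : powers ≈ 1# + t * x * powers
  powers-recurrence = tx-recurrence {powers} {1#} R.refl λ _ → R.sym (R.+-identityˡ _)

  fibonacci-recurrence : fibonacci ≈ 1# + (t * x + t * x ^ 2) * fibonacci
  fibonacci-recurrence = tx+tx²-recurrence {fibonacci} {1#} R.refl
    (R.sym (R.+-identityˡ _)) (λ _ → R.sym (R.+-identityˡ _))

  headed-sums-suc : ∀ n → headed-sums (suc n) R.≈ s ^ᶜ suc n R.+ headed-sums n
  headed-sums-suc n = R.+-congˡ (R.trans
    (R.reflexive (≡.cong (∑ f) (≡.sym (Listₚ.map-tabulate {n = n} id Fin.suc))))
    (∑-map {f = f} Fin.suc (λ _ → R.refl) (allFin n)))
    where
    f : Fin (suc n) → R.Carrier
    f c = s ^ᶜ suc (above c)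

  headed-sums-recurrence : headed-sums ≈ t * x * powers + x * headed-sums
  headed-sums-recurrence = x-recurrence {headed-sums} {t * x * powers}
    (R.sym (tx-zero powers))
    (λ n → R.trans (headed-sums-suc n) (R.+-congʳ (R.sym (tx-suc powers n))))

  lrmax-series-suc-suc : ∀ n → lrmax-series (2 ℕ.+ n) R.≈
    headed-sums n R.+ (s R.* lrmax-series (suc n) R.+ s R.* lrmax-series n)
  lrmax-series-suc-suc n = begin
    ∑ weight (F (2 ℕ.+ n))
      ≈⟨ ∑-↭ weight (F↭F-by-head n) ⟩
    ∑ weight (F-by-head n)
      ≈⟨ ∑-++ weight (List.map 0⊕ᵛ_ (F (suc n))) _ ⟩
    ∑ weight (List.map 0⊕ᵛ_ (F (suc n))) R.+ ∑ weight (List.map 10⊕ᵛ_ (F n) ++ List.map headed (allFin n))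
      ≈⟨ R.+-congˡ (∑-++ weight (List.map 10⊕ᵛ_ (F n)) _) ⟩
    ∑ weight (List.map 0⊕ᵛ_ (F (suc n))) R.+
      (∑ weight (List.map 10⊕ᵛ_ (F n)) R.+ ∑ weight (List.map headed (allFin n)))
      ≈⟨ R.+-assoc (∑ weight (List.map 0⊕ᵛ_ (F (suc n)))) _ _ ⟨
    ∑ weight (List.map 0⊕ᵛ_ (F (suc n))) R.+ ∑ weight (List.map 10⊕ᵛ_ (F n)) R.+
      ∑ weight (List.map headed (allFin n))
      ≈⟨ R.+-comm _ (∑ weight (List.map headed (allFin n))) ⟩
    ∑ weight (List.map headed (allFin n)) R.+
      (∑ weight (List.map 0⊕ᵛ_ (F (suc n))) R.+ ∑ weight (List.map 10⊕ᵛ_ (F n)))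
      ≈⟨ R.+-cong
           (∑-map headed (λ c → R.reflexive (≡.cong (s ^ᶜ_) (lrmax-headed c))) (allFin n))
           (R.+-cong
             (R.trans (∑-map 0⊕ᵛ_ (λ w → R.reflexive (≡.cong (s ^ᶜ_) (lrmax-0⊕ w))) (F (suc n)))
                       (∑-*ˡ s weight (F (suc n))))
             (R.trans (∑-map 10⊕ᵛ_ (λ w → R.reflexive (≡.cong (s ^ᶜ_) (lrmax-10⊕ w))) (F n))
                       (∑-*ˡ s weight (F n)))) ⟩
    headed-sums n R.+ (s R.* lrmax-series (suc n) R.+ s R.* lrmax-series n) ∎
    where open SetoidReasoning R.setoid

  lrmax-series-recurrence : lrmax-series ≈ (1# + x ^ 2 * headed-sums) + (t * x + t * x ^ 2) * lrmax-series
  lrmax-series-recurrence = tx+tx²-recurrence {lrmax-series} {1# + x ^ 2 * headed-sums}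
    (begin
      R.1# R.+ R.0#                     ≈⟨ R.+-congˡ (x²-zero headed-sums) ⟨
      R.1# R.+ (x ^ 2 * headed-sums) 0  ∎)
    (begin
      s ^ᶜ 1 R.+ R.0#
        ≈⟨ R.+-identityʳ _ ⟩
      s R.* R.1#
        ≈⟨ R.*-congˡ (R.+-identityʳ _) ⟨
      s R.* lrmax-series 0
        ≈⟨ R.+-identityˡ _ ⟨
      R.0# R.+ s R.* lrmax-series 0
        ≈⟨ R.+-congʳ (R.trans (R.+-identityˡ _) (x²-one headed-sums)) ⟨
      (R.0# R.+ (x ^ 2 * headed-sums) 1) R.+ s R.* lrmax-series 0 ∎)
    (λ n → begin
      lrmax-series (2 ℕ.+ n)
        ≈⟨ lrmax-series-suc-suc n ⟩
      headed-sums n R.+ (s R.* lrmax-series (suc n) R.+ s R.* lrmax-series n)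
        ≈⟨ R.+-congʳ (R.trans (R.+-identityˡ _) (x²-suc-suc headed-sums n)) ⟨
      (R.0# R.+ (x ^ 2 * headed-sums) (2 ℕ.+ n)) R.+ (s R.* lrmax-series (suc n) R.+ s R.* lrmax-series n) ∎)
    where open SetoidReasoning R.setoid

open import Defs using (_+_; _*_; -_; 1#; _^_; _-_; t; x; T; _≈_÷_)

private
  ℤ⟦t⟧-commutativeRing = PowerSeriesProperties.commutativeRing ℤₚ.+-*-commutativeRing
  ℤ⟦t⟧⟦x⟧-commutativeRing = PowerSeriesProperties.commutativeRing ℤ⟦t⟧-commutativeRing

open Enumeration ℤ⟦t⟧-commutativeRing (PowerSeries.variable-series +-*-rawRing)

proposition8p13 : T ≈ (1# - (t + 1#) * x + t * x ^ 2 + t * x ^ 3)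
    ÷ ((1# - t * x - t * x ^ 2) * (1# - t * x) * (1# - x))
proposition8p13 = RationalForm.rational-form ℤ⟦t⟧⟦x⟧-commutativeRing t x
  {f = T} {p = headed-sums} {q = geometric} {e = powers} {g = fibonacci}
  lrmax-series-recurrence headed-sums-recurrence geometric-recurrence powers-recurrence fibonacci-recurrence
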